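{- Let $w_1,w_2,w_3$ be any odd positive integers, let $n\ge 0$ be an integer and let $y_1,y_2\in\mathbb{Z}_p$. Then \begin{align*} &\sum_{k+l+m=n}\binom{n}{k,l,m}E_{k,q^{w_2w_3}}(w_1y_1)E_{l,q^{w_1w_3}}(w_2y_2)T_{m,q^{w_1w_2}}(w_3-1)\,w_1^{l+m}w_2^{k+m}w_3^{k+l}\\ =&\sum_{k+l+m=n}\binom{n}{k,l,m}E_{k,q^{w_2w_3}}(w_1y_1)E_{l,q^{w_1w_2}}(w_3y_2)T_{m,q^{w_1w_3}}(w_2-1)\,w_1^{l+m}w_3^{k+m}w_2^{k+l}\\ =&\sum_{k+l+m=n}\binom{n}{k,l,m}E_{k,q^{w_1w_3}}(w_2y_1)E_{l,q^{w_2w_3}}(w_1y_2)T_{m,q^{w_1w_2}}(w_3-1)\,w_2^{l+m}w_1^{k+m}w_3^{k+l}\\ =&\sum_{k+l+m=n}\binom{n}{k,l,m}E_{k,q^{w_1w_3}}(w_2y_1)E_{l,q^{w_1w_2}}(w_3y_2)T_{m,q^{w_2w_3}}(w_1-1)\,w_2^{l+m}w_3^{k+m}w_1^{k+l}\\ =&\sum_{k+l+m=n}\binom{n}{k,l,m}E_{k,q^{w_1w_2}}(w_3y_1)E_{l,q^{w_1w_3}}(w_2y_2)T_{m,q^{w_2w_3}}(w_1-1)\,w_3^{l+m}w_2^{k+m}w_1^{k+l}\\ =&\sum_{k+l+m=n}\binom{n}{k,l,m}E_{k,q^{w_1w_2}}(w_3y_1)E_{l,q^{w_2w_3}}(w_1y_2)T_{m,q^{w_1w_3}}(w_2-1)\,w_3^{l+m}w_1^{k+m}w_2^{k+l}.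 \end{align*}
   Context: Let $p$ be a fixed odd prime, $\mathbb{C}_p$ the completion of an algebraic closure of $\mathbb{Q}_p$ with absolute value normalized by $|p|_p=1/p$, and let $q\in\mathbb{C}_p$ be fixed with $|q-1|_p<p^{ -1/(p-1)}$. For $r\in\mathbb{C}_p$ with $|r-1|_p<p^{ -1/(p-1)}$ (in particular for $r=q^w$, $w$ a positive integer), the $r$-Euler polynomials $E_{n,r}(x)$ ($n\ge 0$) are the polynomials in $x$ defined by the generating function $$\frac{2}{re^{t}+1}e^{xt}=\sum_{n=0}^{\infty}E_{n,r}(x)\frac{t^n}{n!}.$$ For integers $k,N\ge 0$, the $r$-analogue of the alternating power sum is $T_{k,r}(N)=\sum_{i=0}^{N}(-1)^i i^k r^i$, with the convention $0^0=1$. Sums over $k+l+m=n$ run over all nonnegative integers $k,l,m$ with $k+l+m=n$, and $\binom{n}{k,l,m}=\frac{n!}{k!\,l!\,m!}$. -}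

module Defs where

open import Level using (_⊔_) renaming (suc to lsuc)
open import Algebra.Apartness.Bundles using (HeytingCommutativeRing; HeytingField)
open import Algebra.Bundles using (CommutativeRing; RawRing)
open import Algebra.Morphism.Structures using (module RingMorphisms)
import Algebra.Properties.Monoid.Mult as Mult
import Algebra.Properties.Monoid.Sum as Sum
import Algebra.Properties.Semiring.Exp as Exp
open import Data.Fin.Base using (toℕ)
open import Data.Integer.Base as ℤ using (+_)
open import Data.List.Base as List using (List; []; _∷_)
open import Data.Nat.Base as ℕ using (ℕ; zero; suc; NonZero; >-nonZero; nonTrivial⇒n>1; _!)
open import Data.Nat.Divisibility using (_∣?_)
open import Data.Nat.Primality using (Prime; prime⇒nonTrivial)
open import Data.Nat.Properties using (_!≢0; _!*_!≢0; m*n≢0; m<n⇒0<n∸m)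
open import Data.Product.Base using (Σ-syntax; ∃-syntax; _,_; proj₁)
open import Data.Rational.Base as ℚ using (ℚ; 0ℚ)
import Data.Rational.Properties as ℚ
open import Data.Vec.Base as Vec using (Vec; []; _∷_)
open import Function.Bundles using (_⇔_; Equivalence)
open import Relation.Binary.PropositionalEquality.Core as ≡ using (_≡_)

Odd : ℕ → Set
Odd n = ∃[ k ] n ≡ 1 ℕ.+ 2 ℕ.* k

-- The division is exact when n = k + l + m.
multinomial : (n k l m : ℕ) → ℕ
multinomial n k l m = (n !) ℕ./ (k ! ℕ.* l ! ℕ.* m !)
  where instance
    k!l!m!≢0 : NonZero (k ! ℕ.* l ! ℕ.* m !)
    k!l!m!≢0 = m*n≢0 (k ! ℕ.* l !) (m !) {{k !* l !≢0}} {{m !≢0}}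

-- The set {0} ∪ p^ℚ of nonnegative reals, in which the p-adic absolute
-- value on ℂₚ takes its values; p^ s stands for the real number pˢ.
-- As p > 1, the order is that of the exponents.
data Value : Set where
  0ᵛ  : Value
  p^_ : ℚ → Value

infix 9 p^_
infixl 7 _·ᵛ_
infixl 6 _⊔ᵛ_
infix 4 _<ᵛ_ _≤ᵛ_

1ᵛ : Value
1ᵛ = p^ 0ℚ

_·ᵛ_ : Value → Value → Value
0ᵛ   ·ᵛ _    = 0ᵛ
p^ _ ·ᵛ 0ᵛ   = 0ᵛ
p^ s ·ᵛ p^ t = p^ (s ℚ.+ t)

_⊔ᵛ_ : Value → Value → Value
0ᵛ   ⊔ᵛ v    = v
p^ s ⊔ᵛ 0ᵛ   = p^ s
p^ s ⊔ᵛ p^ t = p^ (s ℚ.⊔ t)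

data _<ᵛ_ : Value → Value → Set where
  0<p^  : ∀ {s} → 0ᵛ <ᵛ p^ s
  p^<p^ : ∀ {s t} → s ℚ.< t → p^ s <ᵛ p^ t

data _≤ᵛ_ : Value → Value → Set where
  0≤    : ∀ {v} → 0ᵛ ≤ᵛ v
  p^≤p^ : ∀ {s t} → s ℚ.≤ t → p^ s ≤ᵛ p^ t

-- p^(-1/(p-1))
expRadius : ∀ {p} → Prime p → Value
expRadius {p} pr = p^ (ℤ.-1ℤ ℚ./ (p ℕ.∸ 1))
  where instance
    p∸1≢0 : NonZero (p ℕ.∸ 1)
    p∸1≢0 = >-nonZero (m<n⇒0<n∸m (nonTrivial⇒n>1 p {{prime⇒nonTrivial pr}}))

-- The exponent of p in n, for p ≥ 2 and n ≥ 1, as the number of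
-- j ∈ {1,…,n} with pʲ ∣ n.
ord : ℕ → ℕ → ℕ
ord p n = List.length (List.filter (λ j → p ℕ.^ suc j ∣? n) (List.upTo n))

∣_/_∣[_] : ℕ → ℕ → ℕ → Value
∣ zero      / b ∣[ p ] = 0ᵛ
∣ a@(suc _) / b ∣[ p ] = p^ ((+ ord p b ℤ.- + ord p a) ℚ./ 1)

padicAbs : ℕ → ℚ → Value
padicAbs p x = ∣ ℤ.∣ ℚ.↥ x ∣ / ℚ.↧ₙ x ∣[ p ]

rawRing : ∀ {c ℓ₁ ℓ₂} → HeytingField c ℓ₁ ℓ₂ → RawRing c ℓ₁
rawRing K = CommutativeRing.rawRing (HeytingCommutativeRing.commutativeRing heytingCommutativeRing)
  where open HeytingField K

IsFieldHomomorphism : ∀ {a b ℓ₁ ℓ₂ ℓ₃ ℓ₄} (K : HeytingField a ℓ₁ ℓ₂) (L : HeytingField b ℓ₃ ℓ₄) →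
                      (HeytingField.Carrier K → HeytingField.Carrier L) → Set (a ⊔ ℓ₁ ⊔ ℓ₃)
IsFieldHomomorphism K L = RingMorphisms.IsRingHomomorphism (rawRing K) (rawRing L)

-- A field with a nonarchimedean absolute value with values in {0} ∪ p^ℚ.
record ValuedField c ℓ₁ ℓ₂ : Set (lsuc (c ⊔ ℓ₁ ⊔ ℓ₂)) where
  infix 8 _⁻¹

  field
    heytingField : HeytingField c ℓ₁ ℓ₂

  open HeytingField heytingField public

  commutativeRing : CommutativeRing c ℓ₁
  commutativeRing = record { isCommutativeRing = isCommutativeRing }

  field
    ∣_∣      : Carrier → Value
    ∣∣-cong  : ∀ {x y} → x ≈ y → ∣ x ∣ ≡ ∣ y ∣
    ∣∣-pos   : ∀ {x} → x # 0# ⇔ 0ᵛ <ᵛ ∣ x ∣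
    ∣∣-*     : ∀ x y → ∣ x * y ∣ ≡ ∣ x ∣ ·ᵛ ∣ y ∣
    ∣∣-ultra : ∀ x y → ∣ x + y ∣ ≤ᵛ ∣ x ∣ ⊔ᵛ ∣ y ∣

  -- The inverse, extended by 0 ⁻¹ = 0.
  inverse : ∀ x v → ∣ x ∣ ≡ v → Carrier
  inverse x 0ᵛ     _  = 0#
  inverse x (p^ s) eq =
    proj₁ (#⇒invertible (Equivalence.from ∣∣-pos (≡.subst (0ᵛ <ᵛ_) (≡.sym eq) 0<p^)))

  _⁻¹ : Carrier → Carrier
  x ⁻¹ = inverse x ∣ x ∣ ≡.refl

  Cauchy : (ℕ → Carrier) → Set
  Cauchy x = ∀ s → ∃[ N ] ∀ m n → N ℕ.≤ m → N ℕ.≤ n → ∣ x m - x n ∣ <ᵛ p^ s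

  Converges : (ℕ → Carrier) → Carrier → Set
  Converges x y = ∀ s → ∃[ N ] ∀ n → N ℕ.≤ n → ∣ x n - y ∣ <ᵛ p^ s

  Complete : Set c
  Complete = ∀ x → Cauchy x → ∃[ y ] Converges x y

  -- c₀ + c₁x + ⋯ + c_{d-1}x^{d-1} + x^d, for the list c₀, …, c_{d-1}.
  evalMonic : List Carrier → Carrier → Carrier
  evalMonic []       x = 1#
  evalMonic (c ∷ cs) x = c + x * evalMonic cs x

  AlgebraicallyClosed : Set (c ⊔ ℓ₁)
  AlgebraicallyClosed = ∀ c cs → ∃[ x ] evalMonic (c ∷ cs) x ≈ 0#

record IsCompletion {a b ℓ₁ ℓ₂ ℓ₃ ℓ₄} (K : HeytingField a ℓ₁ ℓ₂)
                    (∣_∣ᴷ : HeytingField.Carrier K → Value) (L : ValuedField b ℓ₃ ℓ₄)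
                    (ι : HeytingField.Carrier K → ValuedField.Carrier L)
                    : Set (a ⊔ b ⊔ ℓ₁ ⊔ ℓ₃) where
  open ValuedField L
  field
    isHomomorphism : IsFieldHomomorphism K heytingField ι
    isometric      : ∀ x → ∣ ι x ∣ ≡ ∣ x ∣ᴷ
    dense          : ∀ y s → ∃[ x ] ∣ y - ι x ∣ <ᵛ p^ s
    complete       : Complete

-- The absolute value of L is required to extend that of K.
record IsAlgebraicClosure {a b ℓ₁ ℓ₂ ℓ₃ ℓ₄} (K : ValuedField a ℓ₁ ℓ₂) (L : ValuedField b ℓ₃ ℓ₄)
                          (ι : ValuedField.Carrier K → ValuedField.Carrier L)
                          : Set (a ⊔ b ⊔ ℓ₁ ⊔ ℓ₃) where
  open ValuedField L
  field
    isHomomorphism      : IsFieldHomomorphism (ValuedField.heytingField K) heytingField ι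
    isometric           : ∀ x → ∣ ι x ∣ ≡ ValuedField.∣_∣ K x
    algebraic           : ∀ y → ∃[ cs ] evalMonic (List.map ι cs) y ≈ 0#
    algebraicallyClosed : AlgebraicallyClosed

-- ℂₚ as the completion of an algebraic closure of ℚₚ, itself the
-- completion of ℚ. These data determine ℂₚ up to isometric isomorphism.
record PadicComplexNumbers (p : ℕ) c ℓ₁ ℓ₂ : Set (lsuc (c ⊔ ℓ₁ ⊔ ℓ₂)) where
  field
    ℚₚ ℚₚᵃ ℂₚ : ValuedField c ℓ₁ ℓ₂

  private
    module ℚₚ  = ValuedField ℚₚ
    module ℚₚᵃ = ValuedField ℚₚᵃ
    module ℂₚ  = ValuedField ℂₚ

  field
    ℚ→ℚₚ   : ℚ → ℚₚ.Carrier
    ℚₚ→ℚₚᵃ : ℚₚ.Carrier → ℚₚᵃ.Carrier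
    ℚₚᵃ→ℂₚ : ℚₚᵃ.Carrier → ℂₚ.Carrier

    ℚₚ-isCompletion        : IsCompletion ℚ.heytingField (padicAbs p) ℚₚ ℚ→ℚₚ
    ℚₚᵃ-isAlgebraicClosure : IsAlgebraicClosure ℚₚ ℚₚᵃ ℚₚ→ℚₚᵃ
    ℂₚ-isCompletion        : IsCompletion ℚₚᵃ.heytingField ℚₚᵃ.∣_∣ ℂₚ ℚₚᵃ→ℂₚ

  ℤₚ : Set c
  ℤₚ = Σ[ y ∈ ℚₚ.Carrier ] ℚₚ.∣ y ∣ ≤ᵛ 1ᵛ

  ℤₚ→ℂₚ : ℤₚ → ℂₚ.Carrier
  ℤₚ→ℂₚ (y , _) = ℚₚᵃ→ℂₚ (ℚₚ→ℚₚᵃ y)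

module Euler {c ℓ₁ ℓ₂} (K : ValuedField c ℓ₁ ℓ₂) where
  open ValuedField K
  open CommutativeRing commutativeRing using (+-monoid; semiring)
  open Sum +-monoid public using (sum; sum-syntax; sum⁺-syntax)
  open Exp semiring public using (_^_)

  fromℕ : ℕ → Carrier
  fromℕ n = Mult._×_ +-monoid n 1#

  ∑[k+l+m=_]_ : ℕ → (ℕ → ℕ → ℕ → Carrier) → Carrier
  ∑[k+l+m= n ] f =
    ∑[ k ≤ n ] (∑[ l ≤ n ℕ.∸ toℕ k ] (f (toℕ k) (toℕ l) (n ℕ.∸ toℕ k ℕ.∸ toℕ l)))

  infixr 5 ∑[k+l+m=_]_

  -- Formal power series in t, as coefficient sequences.
  Series : Set c
  Series = ℕ → Carrier

  const : Carrier → Series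
  const a zero    = a
  const a (suc _) = 0#

  infixl 7 _⊛_ _⊘_
  infixl 6 _⊕_

  _⊕_ : Series → Series → Series
  (f ⊕ g) n = f n + g n

  _⊛_ : Series → Series → Series
  (f ⊛ g) n = ∑[ i ≤ n ] (f (toℕ i) * g (n ℕ.∸ toℕ i))

  -- The coefficients hₙ, …, h₀ of 1/g, from h₀ = 1/g₀ and
  -- g₀ hₙ₊₁ = - (g₁ hₙ + ⋯ + gₙ₊₁ h₀).
  recipCoeffs : Series → (n : ℕ) → Vec Carrier (suc n)
  recipCoeffs g zero    = g 0 ⁻¹ ∷ []
  recipCoeffs g (suc n) =
    let hs = recipCoeffs g n
    in - (g 0 ⁻¹ * ∑[ i ≤ n ] (g (suc (toℕ i)) * Vec.lookup hs i)) ∷ hs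

  -- Meaningful when g₀ ≠ 0.
  _⊘_ : Series → Series → Series
  f ⊘ g = f ⊛ (λ n → Vec.head (recipCoeffs g n))

  -- e^{xt}
  exp : Carrier → Series
  exp x n = x ^ n * fromℕ (n !) ⁻¹

  -- The value at x of the r-Euler polynomial E_{n,r}, that is, n! times
  -- the coefficient of tⁿ in 2/(re^t+1) e^{xt}. The constant term r + 1
  -- of the denominator is nonzero when |r-1| < 1 and p is odd.
  E : ℕ → Carrier → Carrier → Carrier
  E n r x = fromℕ (n !) * ((const (fromℕ 2) ⊘ (const r ⊛ exp 1# ⊕ const 1#)) ⊛ exp x) n

  T : ℕ → Carrier → ℕ → Carrier
  T k r N = ∑[ i ≤ N ] ((- 1#) ^ toℕ i * fromℕ (toℕ i ℕ.^ k) * r ^ toℕ i)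

{-# OPTIONS --safe #-}
module Submission where

-- In terms of exponential generating functions, the first sum is n! times the
-- coefficient of tⁿ in
--
--   4 e^{w₁w₂w₃(y₁+y₂)t} (q^{w₁w₂w₃} e^{w₁w₂w₃t} + 1)
--     / ((q^{w₂w₃} e^{w₂w₃t} + 1) (q^{w₁w₃} e^{w₁w₃t} + 1) (q^{w₁w₂} e^{w₁w₂t} + 1))
--
-- because for odd w₃ the alternating power sums are generated by the geometric
-- sum Σ_{i<w₃} (-z)ⁱ = (z^{w₃} + 1)/(z + 1) with z = q^{w₁w₂} e^{w₁w₂t}. The
-- quotient is symmetric in w₁, w₂, w₃. The denominators are invertible series
-- since |qᵐ - 1| < 1 = |2| forces qᵐ + 1 ≠ 0.

open import Defs
open import Algebra.Bundles using (CommutativeRing; CommutativeSemiring)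
open import Algebra.Morphism.Construct.Composition using (isRingHomomorphism)
open import Algebra.Morphism.Structures using (module RingMorphisms)
import Algebra.Properties.CommutativeSemiring.Exp as CommutativeSemiringExp
import Algebra.Properties.Ring as RingProperties
import Algebra.Properties.Semiring.Mult as SemiringMult
import Algebra.Properties.Semiring.Sum as SemiringSum
import Algebra.Solver.Ring.NaturalCoefficients.Default as SemiringSolver
open import Algebra.Structures.Biased using (isCommutativeSemiringˡ)
open import Data.Fin.Base as Fin using (Fin; toℕ)
open import Data.Fin.Properties using (toℕ≤pred[n])
open import Data.Integer.Base as ℤ using (+_)
import Data.Integer.Properties as ℤ
open import Data.List.Base as List using ()
open import Data.List.Properties using (filter-none)
import Data.List.Relation.Unary.All as All
open import Data.Nat.Base as ℕ using (ℕ; zero; suc; NonZero; _!)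
open import Data.Nat.Combinatorics using (k![n∸k]!∣n!)
open import Data.Nat.Coprimality as Coprime using (1-coprimeTo)
open import Data.Nat.Divisibility as ℕ using (_∣_; _∣?_)
open import Data.Nat.DivMod using (m/n*n≡m)
open import Data.Nat.Primality using (Prime; prime⇒nonTrivial; ¬prime[1])
import Data.Nat.Properties as ℕ
open import Data.Nat.Solver using (module +-*-Solver)
open import Data.Product.Base using (_×_; _,_; proj₂)
open import Data.Rational.Base as ℚ using (ℚ; 1ℚ)
import Data.Rational.Properties as ℚ
open import Data.Sum.Base as Sum using (_⊎_; inj₁; inj₂; [_,_]′)
open import Data.Vec.Base as Vec using ()
open import Function.Base using (_∘_; case_of_)
open import Function.Bundles using (Equivalence)
open import Level using (Level)
open import Relation.Binary.PropositionalEquality as ≡ using (_≡_; _≢_)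
import Relation.Binary.Reasoning.Setoid as SetoidReasoning
open import Relation.Binary.Structures using (IsEquivalence)
open import Relation.Nullary.Negation using (¬_; contradiction)

-- The weights w₁^(l+m) w₂^(k+m) w₃^(k+l) regroup as (w₂w₃)^k (w₁w₃)^l (w₁w₂)^m. Each of the three
-- factors is therefore a coefficient of its own generating function with t rescaled by a product of
-- two weights, and the arguments w₁y₁ and w₂y₂ both become multiples of w₁w₂w₃. This is why the
-- exponential factor does not depend on the order of the weights. The inverse on the field is
-- total, with 0 ⁻¹ = 0, so a quotient carries no information by itself. Every division is replaced
-- by multiplication with a series proved to be a reciprocal, and the remaining rearrangements take
-- place in the commutative semiring of series. Invertibility comes down to two kinds of elements
-- having nonzero absolute value: the positive integers, which are images of nonzero rationals, and
-- the elements qᵐ + 1.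

multinomial*k!l!m!≡n! : ∀ n k l → k ℕ.≤ n → l ℕ.≤ n ℕ.∸ k →
  let m = n ℕ.∸ k ℕ.∸ l in multinomial n k l m ℕ.* (k ! ℕ.* l ! ℕ.* m !) ≡ n !
multinomial*k!l!m!≡n! n k l k≤n l≤n∸k = m/n*n≡m k!l!m!∣n!
  where
  instance
    k!l!m!≢0 : NonZero (k ! ℕ.* l ! ℕ.* (n ℕ.∸ k ℕ.∸ l) !)
    k!l!m!≢0 = ℕ.m*n≢0 (k ! ℕ.* l !) ((n ℕ.∸ k ℕ.∸ l) !) {{ℕ._!*_!≢0 k l}} {{ℕ._!≢0 (n ℕ.∸ k ℕ.∸ l)}}
  -- Exactness of the division comes from two nested binomial coefficients: l! m! divides (n - k)!,
  -- and k! (n - k)! divides n!.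
  k!l!m!∣n! : k ! ℕ.* l ! ℕ.* (n ℕ.∸ k ℕ.∸ l) ! ∣ n !
  k!l!m!∣n! = ≡.subst (_∣ n !) (≡.sym (ℕ.*-assoc (k !) (l !) _))
    (ℕ.∣-trans (ℕ.*-monoʳ-∣ (k !) (k![n∸k]!∣n! l≤n∸k)) (k![n∸k]!∣n! k≤n))

-- The alternating geometric sum in a commutative semiring

module AlternatingGeometricSum {c ℓ} (R : CommutativeSemiring c ℓ) where
  open CommutativeSemiring R
  open CommutativeSemiringExp R using (_^_; ^-congˡ; ^-assocʳ)
  open SemiringSum semiring using (sum⁺-syntax; *-distribˡ-sum)
  open SemiringSolver R using (solve; _:+_; _:*_; _:=_; con)
  open SetoidReasoning setoid

  module _ {x z : Carrier} (x+z≈0 : x + z ≈ 0#) where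

    -- The hypothesis `x+z≈0` encodes z = -x without negation, because series are used only as a
    -- semiring. Cancellation is replaced by adding x(x + z) and regrouping.
    z*z≈x*x : z * z ≈ x * x
    z*z≈x*x = begin
      z * z                ≈⟨ +-identityʳ _ ⟨
      z * z + 0#           ≈⟨ +-congˡ (trans (*-congˡ x+z≈0) (zeroʳ x)) ⟨
      z * z + x * (x + z)  ≈⟨ solve 2 (λ x z → z :* z :+ x :* (x :+ z) := (x :+ z) :* z :+ x :* x) refl x z ⟩
      (x + z) * z + x * x  ≈⟨ +-congʳ (trans (*-congʳ x+z≈0) (zeroˡ z)) ⟩
      0# + x * x           ≈⟨ +-identityˡ _ ⟩
      x * x                ∎

    -- This is (1 - z)(1 + z + ... + z^N) = 1 - z^(N+1), with x written for -z on both sides so that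
    -- no minus sign occurs.
    geometric : ∀ N → (x + 1#) * ∑[ i ≤ N ] (z ^ toℕ i) ≈ 1# + x * z ^ N
    geometric zero = solve 1 (λ x → (x :+ con 1) :* (con 1 :+ con 0) := con 1 :+ x :* con 1) refl x
    geometric (suc N) = begin
      (x + 1#) * (1# + ∑[ i ≤ N ] (z * z ^ toℕ i))
        ≈⟨ *-congˡ (+-congˡ (*-distribˡ-sum z (λ (i : Fin (suc N)) → z ^ toℕ i))) ⟨
      (x + 1#) * (1# + z * G)
        ≈⟨ solve 3 (λ x z G → (x :+ con 1) :* (con 1 :+ z :* G) := (x :+ con 1) :+ z :* ((x :+ con 1) :* G)) refl x z G ⟩
      (x + 1#) + z * ((x + 1#) * G)
        ≈⟨ +-congˡ (*-congˡ (geometric N)) ⟩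
      (x + 1#) + z * (1# + x * z ^ N)
        ≈⟨ solve 3 (λ x z p → (x :+ con 1) :+ z :* (con 1 :+ x :* p) := (x :+ z) :+ (con 1 :+ x :* (z :* p))) refl x z (z ^ N) ⟩
      (x + z) + (1# + x * (z * z ^ N))
        ≈⟨ trans (+-congʳ x+z≈0) (+-identityˡ _) ⟩
      1# + x * (z * z ^ N) ∎
      where G = ∑[ i ≤ N ] (z ^ toℕ i)

    -- Oddness enters here: for w = 2k + 1 the top exponent 2k is even, so z^(2k) may be exchanged
    -- for x^(2k).
    [x+1]*alternatingSum : ∀ {w} → Odd w → (x + 1#) * ∑[ i ≤ w ℕ.∸ 1 ] (z ^ toℕ i) ≈ x ^ w + 1#
    [x+1]*alternatingSum {w} (k , ≡.refl) = begin
      (x + 1#) * ∑[ i ≤ 2 ℕ.* k ] (z ^ toℕ i)  ≈⟨ geometric (2 ℕ.* k) ⟩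
      1# + x * z ^ (2 ℕ.* k)                   ≈⟨ +-congˡ (*-congˡ (^-assocʳ z 2 k)) ⟨
      1# + x * (z ^ 2) ^ k                     ≈⟨ +-congˡ (*-congˡ (^-congˡ k z²≈x²)) ⟩
      1# + x * (x ^ 2) ^ k                     ≈⟨ +-congˡ (*-congˡ (^-assocʳ x 2 k)) ⟩
      1# + x * x ^ (2 ℕ.* k)                   ≈⟨ +-comm _ _ ⟩
      x ^ w + 1#                               ∎
      where
      z²≈x² : z ^ 2 ≈ x ^ 2
      z²≈x² = begin
        z * (z * 1#)  ≈⟨ *-congˡ (*-identityʳ z) ⟩
        z * z         ≈⟨ z*z≈x*x ⟩
        x * x         ≈⟨ *-congˡ (*-identityʳ x) ⟨
        x * (x * 1#)  ∎

-- Formal power series under the Cauchy product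

module SeriesRing {c ℓ₁ ℓ₂} (K : ValuedField c ℓ₁ ℓ₂) where
  open ValuedField K using (Carrier; commutativeRing; _⁻¹)
  open CommutativeRing commutativeRing hiding (Carrier)
  open Euler K
  open CommutativeSemiringExp commutativeSemiring using (^-distrib-*)
  open SemiringSum semiring using (sum-cong-≋; *-distribˡ-sum)
  open SemiringSolver commutativeSemiring using (solve; _:+_; _:*_; _:=_; con)
  open SetoidReasoning setoid

  PositiveIntegersInvertible : Set ℓ₁
  PositiveIntegersInvertible = ∀ n .{{_ : NonZero n}} → fromℕ n * fromℕ n ⁻¹ ≈ 1#

  infix 4 _≐_
  _≐_ : Series → Series → Set ℓ₁
  f ≐ g = ∀ n → f n ≈ g n

  ⊛-cong : ∀ {f f′ g g′} → f ≐ f′ → g ≐ g′ → f ⊛ g ≐ f′ ⊛ g′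
  ⊛-cong f≐f′ g≐g′ n = sum-cong-≋ {suc n} (λ i → *-cong (f≐f′ (toℕ i)) (g≐g′ (n ℕ.∸ toℕ i)))

  -- The recursion (f ⊛ g) (suc n) = f 0 * g (suc n) + (f ∘ suc ⊛ g) n holds
  -- definitionally, and this is its mirror image.
  ⊛-sucʳ : ∀ f g n → (f ⊛ g) (suc n) ≈ f (suc n) * g 0 + (f ⊛ (g ∘ suc)) n
  ⊛-sucʳ f g zero = solve 4 (λ a b c d → a :* b :+ (c :* d :+ con 0) := c :* d :+ (a :* b :+ con 0)) refl (f 0) (g 1) (f 1) (g 0)
  ⊛-sucʳ f g (suc n) = begin
    f 0 * g (suc (suc n)) + ((f ∘ suc) ⊛ g) (suc n)
      ≈⟨ +-congˡ (⊛-sucʳ (f ∘ suc) g n) ⟩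
    f 0 * g (suc (suc n)) + (f (suc (suc n)) * g 0 + ((f ∘ suc) ⊛ (g ∘ suc)) n)
      ≈⟨ solve 3 (λ a b c → a :+ (b :+ c) := b :+ (a :+ c)) refl _ _ _ ⟩
    f (suc (suc n)) * g 0 + (f ⊛ (g ∘ suc)) (suc n) ∎

  -- Splitting off the last term on one side and the first on the other leaves a shorter
  -- convolution, so no finite sum has to be reindexed.
  ⊛-comm : ∀ f g → f ⊛ g ≐ g ⊛ f
  ⊛-comm f g zero = +-congʳ (*-comm _ _)
  ⊛-comm f g (suc n) = begin
    (f ⊛ g) (suc n)                      ≈⟨ ⊛-sucʳ f g n ⟩
    f (suc n) * g 0 + (f ⊛ (g ∘ suc)) n  ≈⟨ +-cong (*-comm _ _) (⊛-comm f (g ∘ suc) n) ⟩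
    g 0 * f (suc n) + ((g ∘ suc) ⊛ f) n  ∎

  ⊛-distribʳ-⊕ : ∀ h f g → (f ⊕ g) ⊛ h ≐ f ⊛ h ⊕ g ⊛ h
  ⊛-distribʳ-⊕ h f g zero = solve 3 (λ h f g → (f :+ g) :* h :+ con 0 := (f :* h :+ con 0) :+ (g :* h :+ con 0)) refl (h 0) (f 0) (g 0)
  ⊛-distribʳ-⊕ h f g (suc n) = begin
    (f 0 + g 0) * h (suc n) + ((f ∘ suc ⊕ g ∘ suc) ⊛ h) n
      ≈⟨ +-congˡ (⊛-distribʳ-⊕ h (f ∘ suc) (g ∘ suc) n) ⟩
    (f 0 + g 0) * h (suc n) + (((f ∘ suc) ⊛ h) n + ((g ∘ suc) ⊛ h) n)
      ≈⟨ solve 5 (λ f g h a b → (f :+ g) :* h :+ (a :+ b) := (f :* h :+ a) :+ (g :* h :+ b)) refl _ _ _ _ _ ⟩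
    (f ⊛ h) (suc n) + (g ⊛ h) (suc n) ∎

  ⊛-homogeneous : ∀ a f g → (λ n → a * f n) ⊛ g ≐ λ n → a * (f ⊛ g) n
  ⊛-homogeneous a f g n = begin
    ∑[ i ≤ n ] (a * f (toℕ i) * g (n ℕ.∸ toℕ i))    ≈⟨ sum-cong-≋ {suc n} (λ i → *-assoc a (f (toℕ i)) (g (n ℕ.∸ toℕ i))) ⟩
    ∑[ i ≤ n ] (a * (f (toℕ i) * g (n ℕ.∸ toℕ i)))  ≈⟨ *-distribˡ-sum a (λ (i : Fin (suc n)) → f (toℕ i) * g (n ℕ.∸ toℕ i)) ⟨
    a * (f ⊛ g) n                                   ∎

  const-⊛ : ∀ a f → const a ⊛ f ≐ λ n → a * f n
  const-⊛ a f zero    = +-identityʳ _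
  const-⊛ a f (suc n) = trans (+-congˡ (0-⊛ n)) (+-identityʳ _)
    where
    0-⊛ : (λ _ → 0#) ⊛ f ≐ λ _ → 0#
    0-⊛ zero    = trans (+-identityʳ _) (zeroˡ _)
    0-⊛ (suc n) = trans (+-cong (zeroˡ _) (0-⊛ n)) (+-identityˡ _)

  ⊛-zeroˡ : ∀ f → const 0# ⊛ f ≐ const 0#
  ⊛-zeroˡ f zero    = trans (const-⊛ 0# f 0) (zeroˡ _)
  ⊛-zeroˡ f (suc n) = trans (const-⊛ 0# f (suc n)) (zeroˡ _)

  ⊛-assoc : ∀ f g h → (f ⊛ g) ⊛ h ≐ f ⊛ (g ⊛ h)
  ⊛-assoc f g h zero = solve 3 (λ f g h → (f :* g :+ con 0) :* h :+ con 0 := f :* (g :* h :+ con 0) :+ con 0) refl (f 0) (g 0) (h 0)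
  ⊛-assoc f g h (suc n) = begin
    (f 0 * g 0 + 0#) * h (suc n) + (((λ i → f 0 * g (suc i)) ⊕ (f ∘ suc) ⊛ g) ⊛ h) n
      ≈⟨ +-congˡ (⊛-distribʳ-⊕ h (λ i → f 0 * g (suc i)) ((f ∘ suc) ⊛ g) n) ⟩
    (f 0 * g 0 + 0#) * h (suc n) + (((λ i → f 0 * g (suc i)) ⊛ h) n + (((f ∘ suc) ⊛ g) ⊛ h) n)
      ≈⟨ +-congˡ (+-cong (⊛-homogeneous (f 0) (g ∘ suc) h n) (⊛-assoc (f ∘ suc) g h n)) ⟩
    (f 0 * g 0 + 0#) * h (suc n) + (f 0 * ((g ∘ suc) ⊛ h) n + ((f ∘ suc) ⊛ (g ⊛ h)) n)
      ≈⟨ solve 5 (λ f g h a b → (f :* g :+ con 0) :* h :+ (f :* a :+ b) := f :* (g :* h :+ a) :+ b) refl _ _ _ _ _ ⟩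
    f 0 * (g ⊛ h) (suc n) + ((f ∘ suc) ⊛ (g ⊛ h)) n ∎

  seriesSemiring : CommutativeSemiring c ℓ₁
  seriesSemiring = record
    { Carrier = Series
    ; _≈_ = _≐_
    ; _+_ = _⊕_
    ; _*_ = _⊛_
    ; 0# = const 0#
    ; 1# = const 1#
    ; isCommutativeSemiring = isCommutativeSemiringˡ record
      { +-isCommutativeMonoid = record
        { isMonoid = record
          { isSemigroup = record
            { isMagma = record
              { isEquivalence = isEquivalenceˢ
              ; ∙-cong = λ f≐f′ g≐g′ n → +-cong (f≐f′ n) (g≐g′ n)
              }
            ; assoc = λ f g h n → +-assoc (f n) (g n) (h n)
            }
          ; identity = (λ { f zero → +-identityˡ _ ; f (suc n) → +-identityˡ _ })
                     , (λ { f zero → +-identityʳ _ ; f (suc n) → +-identityʳ _ })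
          }
        ; comm = λ f g n → +-comm (f n) (g n)
        }
      ; *-isCommutativeMonoid = record
        { isMonoid = record
          { isSemigroup = record
            { isMagma = record
              { isEquivalence = isEquivalenceˢ
              ; ∙-cong = ⊛-cong
              }
            ; assoc = ⊛-assoc
            }
          ; identity = ⊛-identityˡ , λ f n → trans (⊛-comm f (const 1#) n) (⊛-identityˡ f n)
          }
        ; comm = ⊛-comm
        }
      ; distribʳ = ⊛-distribʳ-⊕
      ; zeroˡ = ⊛-zeroˡ
      }
    }
    where
    isEquivalenceˢ : IsEquivalence _≐_
    isEquivalenceˢ = record { refl = λ _ → refl ; sym = λ p n → sym (p n) ; trans = λ p q n → trans (p n) (q n) }
    ⊛-identityˡ : ∀ f → const 1# ⊛ f ≐ f
    ⊛-identityˡ f n = trans (const-⊛ 1# f n) (*-identityˡ (f n))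

  -- f(at)
  scale : Carrier → Series → Series
  scale a f n = a ^ n * f n

  scale-⊛ : ∀ a f g → scale a (f ⊛ g) ≐ scale a f ⊛ scale a g
  scale-⊛ a f g zero = solve 2 (λ f g → con 1 :* (f :* g :+ con 0) := (con 1 :* f) :* (con 1 :* g) :+ con 0) refl (f 0) (g 0)
  scale-⊛ a f g (suc n) = begin
    a ^ suc n * (f 0 * g (suc n) + ((f ∘ suc) ⊛ g) n)
      ≈⟨ solve 5 (λ a p f g h → (a :* p) :* (f :* g :+ h) := (con 1 :* f) :* ((a :* p) :* g) :+ a :* (p :* h)) refl a (a ^ n) (f 0) (g (suc n)) _ ⟩
    scale a f 0 * scale a g (suc n) + a * (a ^ n * ((f ∘ suc) ⊛ g) n)
      ≈⟨ +-congˡ (*-congˡ (scale-⊛ a (f ∘ suc) g n)) ⟩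
    scale a f 0 * scale a g (suc n) + a * (scale a (f ∘ suc) ⊛ scale a g) n
      ≈⟨ +-congˡ (⊛-homogeneous a (scale a (f ∘ suc)) (scale a g) n) ⟨
    scale a f 0 * scale a g (suc n) + ((λ i → a * scale a (f ∘ suc) i) ⊛ scale a g) n
      ≈⟨ +-congˡ (⊛-cong {g = scale a g} (λ i → sym (*-assoc a (a ^ i) (f (suc i)))) (λ _ → refl) n) ⟩
    (scale a f ⊛ scale a g) (suc n) ∎

  scale-⊕ : ∀ a f g → scale a (f ⊕ g) ≐ scale a f ⊕ scale a g
  scale-⊕ a f g n = distribˡ _ _ _

  scale-const : ∀ a b → scale a (const b) ≐ const b
  scale-const a b zero    = *-identityˡ _
  scale-const a b (suc n) = zeroʳ _

  scale-exp : ∀ a x → scale a (exp x) ≐ exp (a * x)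
  scale-exp a x n = begin
    a ^ n * (x ^ n * fromℕ (n !) ⁻¹)  ≈⟨ *-assoc _ _ _ ⟨
    a ^ n * x ^ n * fromℕ (n !) ⁻¹    ≈⟨ *-congʳ (^-distrib-* a x n) ⟨
    (a * x) ^ n * fromℕ (n !) ⁻¹      ∎

  -- The operator t d/dt.
  θ : Series → Series
  θ f n = fromℕ n * f n

  -- The Leibniz rule, through which products of exponentials are recognized by their differential
  -- equation. Unlike d/dt, `θ` does not shift indices; in the induction the factor 1 + n splits, so
  -- that `θ f ∘ suc` is `f ∘ suc` plus `θ (f ∘ suc)`.
  θ-⊛ : ∀ f g → θ (f ⊛ g) ≐ θ f ⊛ g ⊕ f ⊛ θ g
  θ-⊛ f g zero = solve 2 (λ f g → con 0 :* (f :* g :+ con 0) := ((con 0 :* f) :* g :+ con 0) :+ (f :* (con 0 :* g) :+ con 0)) refl (f 0) (g 0)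
  θ-⊛ f g (suc n) = begin
    (1# + fromℕ n) * (f 0 * g (suc n) + F n)
      ≈⟨ solve 4 (λ m f g h → (con 1 :+ m) :* (f :* g :+ h)
                      := ((con 0 :* f) :* g :+ f :* ((con 1 :+ m) :* g)) :+ (h :+ m :* h)) refl
           (fromℕ n) (f 0) (g (suc n)) (F n) ⟩
    (0# * f 0 * g (suc n) + f 0 * θ g (suc n)) + (F n + fromℕ n * F n)
      ≈⟨ +-congˡ (+-congˡ (θ-⊛ (f ∘ suc) g n)) ⟩
    (0# * f 0 * g (suc n) + f 0 * θ g (suc n)) + (F n + ((θ (f ∘ suc) ⊛ g) n + ((f ∘ suc) ⊛ θ g) n))
      ≈⟨ solve 5 (λ a b c d e → (a :+ b) :+ (c :+ (d :+ e)) := (a :+ (c :+ d)) :+ (b :+ e)) refl _ _ _ _ _ ⟩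
    (0# * f 0 * g (suc n) + (F n + (θ (f ∘ suc) ⊛ g) n)) + (f ⊛ θ g) (suc n)
      ≈⟨ +-congʳ (+-congˡ (⊛-distribʳ-⊕ g (f ∘ suc) (θ (f ∘ suc)) n)) ⟨
    (0# * f 0 * g (suc n) + ((f ∘ suc ⊕ θ (f ∘ suc)) ⊛ g) n) + (f ⊛ θ g) (suc n)
      ≈⟨ +-congʳ (+-congˡ (⊛-cong {g = g}
           (λ i → solve 2 (λ m f → f :+ m :* f := (con 1 :+ m) :* f) refl (fromℕ i) (f (suc i))) (λ _ → refl) n)) ⟩
    (θ f ⊛ g) (suc n) + (f ⊛ θ g) (suc n) ∎
    where F = (f ∘ suc) ⊛ g

  recip : Series → Series
  recip g n = Vec.head (recipCoeffs g n)

  -- The vector runs from the newest coefficient down to the oldest, which is the order in which a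
  -- convolution pairs it with g₁, g₂, ....
  lookup-recipCoeffs : ∀ g n (i : Fin (suc n)) → Vec.lookup (recipCoeffs g n) i ≡ recip g (n ℕ.∸ toℕ i)
  lookup-recipCoeffs g zero    Fin.zero    = ≡.refl
  lookup-recipCoeffs g (suc n) Fin.zero    = ≡.refl
  lookup-recipCoeffs g (suc n) (Fin.suc i) = lookup-recipCoeffs g n i

  -- The recursion defining a new coefficient says exactly that the next coefficient of the product
  -- vanishes; it can be solved because g₀ is invertible.
  recip-inverse : ∀ {g} → g 0 * g 0 ⁻¹ ≈ 1# → g ⊛ recip g ≐ const 1#
  recip-inverse inv zero = trans (+-identityʳ _) inv
  recip-inverse {g} inv (suc n) = begin
    g 0 * (- (g 0 ⁻¹ * A)) + ((g ∘ suc) ⊛ recip g) n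
      ≈⟨ +-cong (sym (-‿distribʳ-* _ _)) (sum-cong-≋ {suc n}
           (λ i → *-congˡ {g (suc (toℕ i))} (reflexive (≡.sym (lookup-recipCoeffs g n i))))) ⟩
    - (g 0 * (g 0 ⁻¹ * A)) + A
      ≈⟨ +-congʳ (-‿cong (trans (sym (*-assoc _ _ _)) (trans (*-congʳ inv) (*-identityˡ A)))) ⟩
    - A + A
      ≈⟨ -‿inverseˡ A ⟩
    0# ∎
    where
    open RingProperties ring using (-‿distribʳ-*)
    A = ∑[ i ≤ n ] (g (suc (toℕ i)) * Vec.lookup (recipCoeffs g n) i)

module TrinomialSum {c ℓ₁ ℓ₂} (K : ValuedField c ℓ₁ ℓ₂) where
  open ValuedField K
  open Euler K

  -- One formula for all six sums: `a`, `b`, `c` are the weights in some order, with `u` = bc, `v` =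
  -- ac, `s` = ab intended. The products stay independent parameters because q^(w₂w₃) and q^(w₃w₂)
  -- are not definitionally equal, and the stated sums must be instances of this formula by
  -- unfolding.
  summand : (q y₁ y₂ : Carrier) (n a b c u v s k l m : ℕ) → Carrier
  summand q y₁ y₂ n a b c u v s k l m =
    fromℕ (multinomial n k l m) * E k (q ^ u) (fromℕ a * y₁) * E l (q ^ v) (fromℕ b * y₂) * T m (q ^ s) (c ℕ.∸ 1)
      * fromℕ a ^ (l ℕ.+ m) * fromℕ b ^ (k ℕ.+ m) * fromℕ c ^ (k ℕ.+ l)

-- Generating functions of Euler polynomials and alternating power sums

module EulerSeries {c ℓ₁ ℓ₂} (K : ValuedField c ℓ₁ ℓ₂)
  (fromℕ-inverse : SeriesRing.PositiveIntegersInvertible K) where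
  open ValuedField K using (Carrier; commutativeRing; _⁻¹)
  open CommutativeRing commutativeRing hiding (Carrier)
  open Euler K
  open TrinomialSum K
  open SeriesRing K
  open CommutativeSemiringExp commutativeSemiring using (^-distrib-*; ^-congˡ; ^-homo-*; ^-assocʳ)
  open SemiringMult semiring using (×1-homo-*)
  open SemiringSum semiring using (sum-cong-≋; *-distribˡ-sum; *-distribʳ-sum)
  open SemiringSolver commutativeSemiring using (solve; _:+_; _:*_; _:=_; con)
  open SetoidReasoning setoid
  open +-*-Solver using () renaming (solve to solveᴺ; _:*_ to _:*ᴺ_; _:=_ to _:=ᴺ_)
  private module 𝕊 = CommutativeSemiring seriesSemiring
  open CommutativeSemiringExp seriesSemiring using () renaming (_^_ to _^ˢ_)
  open SemiringSum 𝕊.semiring using () renaming (sum to sumˢ)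
  open SemiringSolver seriesSemiring using () renaming (solve to solveˢ; _:*_ to _:*ˢ_; _:=_ to _:=ˢ_)

  fromℕ-!-inverse : ∀ n → fromℕ (n !) * fromℕ (n !) ⁻¹ ≈ 1#
  fromℕ-!-inverse n = fromℕ-inverse (n !) {{ℕ._!≢0 n}}

  fromℕ-cancelˡ : ∀ n .{{_ : NonZero n}} {x y} → fromℕ n * x ≈ fromℕ n * y → x ≈ y
  fromℕ-cancelˡ n {x} {y} nx≈ny = begin
    x                          ≈⟨ *-identityˡ x ⟨
    1# * x                     ≈⟨ *-congʳ (fromℕ-inverse n) ⟨
    fromℕ n * fromℕ n ⁻¹ * x   ≈⟨ solve 3 (λ a b x → a :* b :* x := b :* (a :* x)) refl _ _ _ ⟩
    fromℕ n ⁻¹ * (fromℕ n * x) ≈⟨ *-congˡ nx≈ny ⟩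
    fromℕ n ⁻¹ * (fromℕ n * y) ≈⟨ solve 3 (λ a b x → b :* (a :* x) := a :* b :* x) refl _ _ _ ⟩
    fromℕ n * fromℕ n ⁻¹ * y   ≈⟨ *-congʳ (fromℕ-inverse n) ⟩
    1# * y                     ≈⟨ *-identityˡ y ⟩
    y                          ∎

  fromℕ-^ : ∀ m k → fromℕ (m ℕ.^ k) ≈ fromℕ m ^ k
  fromℕ-^ m zero    = +-identityʳ 1#
  fromℕ-^ m (suc k) = trans (×1-homo-* m (m ℕ.^ k)) (*-congˡ (fromℕ-^ m k))

  exp-cong : ∀ {x y} → x ≈ y → exp x ≐ exp y
  exp-cong x≈y n = *-congʳ (^-congˡ n x≈y)

  exp-0 : ∀ x → exp x 0 ≈ 1#
  exp-0 x = trans (*-congʳ (sym (+-identityʳ 1#))) (fromℕ-inverse 1)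

  -- The equation f′ = x f for e^{xt}. Multiplying by n! first lets each factorial meet its own
  -- inverse, so the inverse of the product (n + 1) n! need not be computed.
  exp-suc : ∀ x n → fromℕ (suc n) * exp x (suc n) ≈ x * exp x n
  exp-suc x n = fromℕ-cancelˡ (n !) {{ℕ._!≢0 n}} (begin
    fromℕ (n !) * (fromℕ (suc n) * (x ^ suc n * fromℕ (suc n !) ⁻¹))
      ≈⟨ solve 4 (λ a b p i → a :* (b :* (p :* i)) := p :* ((b :* a) :* i)) refl _ _ _ _ ⟩
    x ^ suc n * ((fromℕ (suc n) * fromℕ (n !)) * fromℕ (suc n !) ⁻¹)
      ≈⟨ *-congˡ (*-congʳ (×1-homo-* (suc n) (n !))) ⟨
    x ^ suc n * (fromℕ (suc n !) * fromℕ (suc n !) ⁻¹)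
      ≈⟨ *-congˡ (trans (fromℕ-!-inverse (suc n)) (sym (fromℕ-!-inverse n))) ⟩
    x ^ suc n * (fromℕ (n !) * fromℕ (n !) ⁻¹)
      ≈⟨ solve 4 (λ x p a i → (x :* p) :* (a :* i) := a :* (x :* (p :* i))) refl _ _ _ _ ⟩
    fromℕ (n !) * (x * exp x n) ∎)

  -- As n + 1 can be cancelled, f′ = x f determines every coefficient from the preceding one.
  exp-unique : ∀ {f x} → f 0 ≈ 1# → (∀ n → fromℕ (suc n) * f (suc n) ≈ x * f n) → f ≐ exp x
  exp-unique {f} {x} f₀ fₛ zero    = trans f₀ (sym (exp-0 x))
  exp-unique {f} {x} f₀ fₛ (suc n) = fromℕ-cancelˡ (suc n) (begin
    fromℕ (suc n) * f (suc n)      ≈⟨ fₛ n ⟩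
    x * f n                        ≈⟨ *-congˡ (exp-unique f₀ fₛ n) ⟩
    x * exp x n                    ≈⟨ exp-suc x n ⟨
    fromℕ (suc n) * exp x (suc n)  ∎)

  -- The product has constant term 1 and satisfies f′ = (x + y) f by the Leibniz rule, which takes
  -- the place of the binomial theorem.
  exp-+ : ∀ x y → exp x ⊛ exp y ≐ exp (x + y)
  exp-+ x y = exp-unique
    (trans (+-identityʳ _) (trans (*-cong (exp-0 x) (exp-0 y)) (*-identityˡ 1#)))
    λ n → begin
      fromℕ (suc n) * (exp x ⊛ exp y) (suc n)
        ≈⟨ θ-⊛ (exp x) (exp y) (suc n) ⟩
      (θ (exp x) ⊛ exp y) (suc n) + (exp x ⊛ θ (exp y)) (suc n)
        ≈⟨ +-cong (θexp-⊛ x (exp y) n) (trans (⊛-comm (exp x) (θ (exp y)) (suc n)) (θexp-⊛ y (exp x) n)) ⟩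
      x * (exp x ⊛ exp y) n + y * (exp y ⊛ exp x) n
        ≈⟨ +-congˡ (*-congˡ (⊛-comm (exp y) (exp x) n)) ⟩
      x * (exp x ⊛ exp y) n + y * (exp x ⊛ exp y) n
        ≈⟨ distribʳ _ x y ⟨
      (x + y) * (exp x ⊛ exp y) n ∎
    where
    θexp-⊛ : ∀ x g n → (θ (exp x) ⊛ g) (suc n) ≈ x * (exp x ⊛ g) n
    θexp-⊛ x g n = begin
      0# * exp x 0 * g (suc n) + ((θ (exp x) ∘ suc) ⊛ g) n
        ≈⟨ +-cong (trans (*-congʳ (zeroˡ _)) (zeroˡ _)) (⊛-cong {g = g} (exp-suc x) (λ _ → refl) n) ⟩
      0# + ((λ i → x * exp x i) ⊛ g) n
        ≈⟨ trans (+-identityˡ _) (⊛-homogeneous x (exp x) g n) ⟩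
      x * (exp x ⊛ g) n ∎

  const-cong : ∀ {a b} → a ≈ b → const a ≐ const b
  const-cong a≈b zero    = a≈b
  const-cong a≈b (suc _) = refl

  -- r eˢᵗ
  monomial : Carrier → Carrier → Series
  monomial r s = const r ⊛ exp s

  monomial-⊛ : ∀ r s r′ s′ → monomial r s ⊛ monomial r′ s′ ≐ monomial (r * r′) (s + s′)
  monomial-⊛ r s r′ s′ = 𝕊.trans
    (solveˢ 4 (λ a e b f → (a :*ˢ e) :*ˢ (b :*ˢ f) :=ˢ (a :*ˢ b) :*ˢ (e :*ˢ f)) 𝕊.refl (const r) (exp s) (const r′) (exp s′))
    (𝕊.*-cong const-* (exp-+ s s′))
    where
    const-* : const r ⊛ const r′ ≐ const (r * r′)
    const-* zero    = const-⊛ r (const r′) 0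
    const-* (suc n) = trans (const-⊛ r (const r′) (suc n)) (zeroʳ r)

  monomial-cong : ∀ {r r′ s s′} → r ≈ r′ → s ≈ s′ → monomial r s ≐ monomial r′ s′
  monomial-cong r≈r′ s≈s′ = 𝕊.*-cong (const-cong r≈r′) (exp-cong s≈s′)

  monomial-^ : ∀ r s i → monomial r s ^ˢ i ≐ monomial (r ^ i) (fromℕ i * s)
  monomial-^ r s zero    = 𝕊.sym (𝕊.trans (𝕊.*-congˡ {const 1#} (𝕊.trans (exp-cong (zeroˡ s)) (𝕊.sym const-1)))  (𝕊.*-identityʳ (const 1#)))
    where
    const-1 : const 1# ≐ exp 0#
    const-1 = exp-unique refl (λ n → trans (zeroʳ _) (sym (zeroˡ _)))
  monomial-^ r s (suc i) = 𝕊.trans (𝕊.*-congˡ {monomial r s} (monomial-^ r s i))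
    (𝕊.trans (monomial-⊛ r s (r ^ i) (fromℕ i * s)) (monomial-cong refl (solve 2 (λ s i → s :+ i :* s := (con 1 :+ i) :* s) refl s (fromℕ i))))

  -- For z = -r e^{st} the power zⁱ is (-r)ⁱ e^{ist}, with coefficient (-r)ⁱ (is)^m / m! at t^m. At
  -- i = m = 0 both sides use 0^0 = 1.
  T-series : ∀ m r s N →
    T m r N * s ^ m ≈ fromℕ (m !) * sumˢ {suc N} (λ i → monomial (- r) s ^ˢ toℕ i) m
  T-series m r s N = begin
    T m r N * s ^ m
      ≈⟨ *-distribʳ-sum {suc N} (s ^ m) (λ i → (- 1#) ^ toℕ i * fromℕ (toℕ i ℕ.^ m) * r ^ toℕ i) ⟩
    ∑[ i ≤ N ] ((- 1#) ^ toℕ i * fromℕ (toℕ i ℕ.^ m) * r ^ toℕ i * s ^ m)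
      ≈⟨ sum-cong-≋ {suc N} (λ i → term (toℕ i)) ⟩
    ∑[ i ≤ N ] (fromℕ (m !) * (monomial (- r) s ^ˢ toℕ i) m)
      ≈⟨ *-distribˡ-sum {suc N} (fromℕ (m !)) (λ i → (monomial (- r) s ^ˢ toℕ i) m) ⟨
    fromℕ (m !) * ∑[ i ≤ N ] ((monomial (- r) s ^ˢ toℕ i) m)
      ≈⟨ *-congˡ (sumˢ-coeff (suc N) (λ i → monomial (- r) s ^ˢ toℕ i)) ⟨
    fromℕ (m !) * sumˢ {suc N} (λ i → monomial (- r) s ^ˢ toℕ i) m ∎
    where
    open RingProperties ring using (-1*x≈-x)
    sumˢ-coeff : ∀ N (f : Fin N → Series) → sumˢ f m ≈ ∑[ i < N ] (f i m)
    sumˢ-coeff zero    f = const-0 m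
      where
      const-0 : const 0# ≐ λ _ → 0#
      const-0 zero    = refl
      const-0 (suc _) = refl
    sumˢ-coeff (suc N) f = +-congˡ (sumˢ-coeff N (f ∘ Fin.suc))
    term : ∀ i → (- 1#) ^ i * fromℕ (i ℕ.^ m) * r ^ i * s ^ m ≈ fromℕ (m !) * (monomial (- r) s ^ˢ i) m
    term i = begin
      (- 1#) ^ i * fromℕ (i ℕ.^ m) * r ^ i * s ^ m
        ≈⟨ *-congʳ (*-congʳ (*-congˡ (fromℕ-^ i m))) ⟩
      (- 1#) ^ i * fromℕ i ^ m * r ^ i * s ^ m
        ≈⟨ solve 4 (λ a b c d → a :* b :* c :* d := con 1 :* ((a :* c) :* (b :* d))) refl _ _ _ _ ⟩
      1# * (((- 1#) ^ i * r ^ i) * (fromℕ i ^ m * s ^ m))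
        ≈⟨ *-cong (fromℕ-!-inverse m) (*-cong (trans (^-congˡ i (sym (-1*x≈-x r))) (^-distrib-* (- 1#) r i))
             (^-distrib-* (fromℕ i) s m)) ⟨
      (fromℕ (m !) * fromℕ (m !) ⁻¹) * ((- r) ^ i * (fromℕ i * s) ^ m)
        ≈⟨ solve 4 (λ a b c d → (a :* b) :* (c :* d) := a :* (c :* (d :* b))) refl _ _ _ _ ⟩
      fromℕ (m !) * ((- r) ^ i * exp (fromℕ i * s) m)
        ≈⟨ *-congˡ (const-⊛ ((- r) ^ i) (exp (fromℕ i * s)) m) ⟨
      fromℕ (m !) * monomial ((- r) ^ i) (fromℕ i * s) m
        ≈⟨ *-congˡ (monomial-^ (- r) s i m) ⟨
      fromℕ (m !) * (monomial (- r) s ^ˢ i) m ∎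

  -- r eˢᵗ + 1
  denominator : Carrier → Carrier → Series
  denominator r s = monomial r s ⊕ const 1#

  denominator-0 : ∀ r → denominator r 1# 0 ≈ r + 1#
  denominator-0 r = +-congʳ (trans (+-identityʳ _) (trans (*-congˡ (exp-0 1#)) (*-identityʳ r)))

  -- The reciprocal is formed at scale 1, where `E` uses it, and t is rescaled afterwards.
  recipDenominator : Carrier → Carrier → Series
  recipDenominator r s = scale s (recip (denominator r 1#))

  -- Rescaling t is multiplicative, so the reciprocal at scale 1 suffices for every s. The
  -- hypothesis leaves the constant term unsimplified, since this is the very element that
  -- `recipCoeffs` inverts.
  denominator-inverse : ∀ r s → denominator r 1# 0 * denominator r 1# 0 ⁻¹ ≈ 1# →
    denominator r s ⊛ recipDenominator r s ≐ const 1#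
  denominator-inverse r s inv = 𝕊.trans (𝕊.*-congʳ (𝕊.sym scale-denominator))
    (𝕊.trans (𝕊.sym (scale-⊛ s (denominator r 1#) (recip (denominator r 1#))))
      (𝕊.trans (λ n → *-congˡ (recip-inverse {denominator r 1#} inv n)) (scale-const s 1#)))
    where
    scale-denominator : scale s (denominator r 1#) ≐ denominator r s
    scale-denominator = 𝕊.trans (scale-⊕ s (monomial r 1#) (const 1#))
      (𝕊.+-cong (𝕊.trans (scale-⊛ s (const r) (exp 1#))
        (𝕊.*-cong (scale-const s r) (𝕊.trans (scale-exp s 1#) (exp-cong (*-identityʳ s))))) (scale-const s 1#))

  -- The factor sⁿ is absorbed by substituting st for t in the generating function of the Euler
  -- polynomials.
  E-series : ∀ n r x s → E n r x * s ^ n ≈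
    fromℕ (n !) * (const (fromℕ 2) ⊛ recipDenominator r s ⊛ exp (s * x)) n
  E-series n r x s = begin
    fromℕ (n !) * (A ⊛ exp x) n * s ^ n    ≈⟨ trans (*-assoc _ _ _) (*-congˡ (*-comm _ _)) ⟩
    fromℕ (n !) * scale s (A ⊛ exp x) n    ≈⟨ *-congˡ (scaled n) ⟩
    fromℕ (n !) * (const (fromℕ 2) ⊛ recipDenominator r s ⊛ exp (s * x)) n ∎
    where
    A = const (fromℕ 2) ⊛ recip (denominator r 1#)
    scaled : scale s (A ⊛ exp x) ≐ const (fromℕ 2) ⊛ recipDenominator r s ⊛ exp (s * x)
    scaled = 𝕊.trans (scale-⊛ s A (exp x)) (𝕊.*-cong
      (𝕊.trans (scale-⊛ s (const (fromℕ 2)) (recip (denominator r 1#))) (𝕊.*-congʳ (scale-const s (fromℕ 2))))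
      (scale-exp s x))

  -- A coefficient of a threefold Cauchy product is itself such a nested sum. The bounds on k and l
  -- are passed on because the multinomial division is exact only within them.
  trinomial-⊛ : ∀ n d f g h (t : ℕ → ℕ → ℕ → Carrier) →
    (∀ k l → k ℕ.≤ n → l ℕ.≤ n ℕ.∸ k → let m = n ℕ.∸ k ℕ.∸ l in t k l m ≈ d * (f k * (g l * h m))) →
    (∑[k+l+m= n ] t) ≈ d * (f ⊛ (g ⊛ h)) n
  trinomial-⊛ n d f g h t eq = begin
    (∑[k+l+m= n ] t)
      ≈⟨ sum-cong-≋ {suc n} inner ⟩
    ∑[ k ≤ n ] (d * (f (toℕ k) * (g ⊛ h) (n ℕ.∸ toℕ k)))
      ≈⟨ *-distribˡ-sum {suc n} d (λ k → f (toℕ k) * (g ⊛ h) (n ℕ.∸ toℕ k)) ⟨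
    d * (f ⊛ (g ⊛ h)) n ∎
    where
    inner : ∀ (i : Fin (suc n)) → let k = toℕ i in
      ∑[ l ≤ n ℕ.∸ k ] (t k (toℕ l) (n ℕ.∸ k ℕ.∸ toℕ l)) ≈ d * (f k * (g ⊛ h) (n ℕ.∸ k))
    inner i = begin
      ∑[ l ≤ n-k ] (t k (toℕ l) (n-k ℕ.∸ toℕ l))
        ≈⟨ sum-cong-≋ {suc n-k} (λ l → eq k (toℕ l) (toℕ≤pred[n] i) (toℕ≤pred[n] l)) ⟩
      ∑[ l ≤ n-k ] (d * (f k * (g (toℕ l) * h (n-k ℕ.∸ toℕ l))))
        ≈⟨ *-distribˡ-sum {suc n-k} d (λ l → f k * (g (toℕ l) * h (n-k ℕ.∸ toℕ l))) ⟨
      d * ∑[ l ≤ n-k ] (f k * (g (toℕ l) * h (n-k ℕ.∸ toℕ l)))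
        ≈⟨ *-congˡ (*-distribˡ-sum {suc n-k} (f k) (λ l → g (toℕ l) * h (n-k ℕ.∸ toℕ l))) ⟨
      d * (f k * (g ⊛ h) (n-k)) ∎
      where
      k = toℕ i
      n-k = n ℕ.∸ k

  -- The symmetric generating function

  module _ (q : Carrier) (denominator₀-inverse : ∀ m → denominator (q ^ m) 1# 0 * denominator (q ^ m) 1# 0 ⁻¹ ≈ 1#)
           (y₁ y₂ : Carrier) where

    -- 1/(qᵐeᵐᵗ + 1)
    V : ℕ → Series
    V m = recipDenominator (q ^ m) (fromℕ m)

    -- 4 e^{N(y₁+y₂)t} (q^N e^{Nt} + 1)
    numerator : ℕ → Series
    numerator N = (const (fromℕ 2) ⊛ exp (fromℕ N * y₁)) ⊛ (const (fromℕ 2) ⊛ exp (fromℕ N * y₂))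
      ⊛ denominator (q ^ N) (fromℕ N)

    symmetricValue : ℕ → ℕ → ℕ → ℕ → ℕ → Carrier
    symmetricValue n N u v s = fromℕ (n !) * (numerator N ⊛ (V u ⊛ V v ⊛ V s)) n

    -- The sum is multiplied by 1 in the form `V s ⊛ D`; the factor `D` then telescopes it, and
    -- `V s` remains as the denominator.
    alternatingSum≐ : ∀ {w} s N → Odd w → w ℕ.* s ≡ N →
      sumˢ {suc (w ℕ.∸ 1)} (λ i → monomial (- (q ^ s)) (fromℕ s) ^ˢ toℕ i) ≐ V s ⊛ denominator (q ^ N) (fromℕ N)
    alternatingSum≐ {w} s N odd ≡.refl =
      𝕊.trans (𝕊.sym (𝕊.*-identityˡ H))
      (𝕊.trans (𝕊.*-congʳ {H} (𝕊.sym (𝕊.trans (⊛-comm (V s) D) (denominator-inverse (q ^ s) (fromℕ s) (denominator₀-inverse s)))))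
      (𝕊.trans (⊛-assoc (V s) D H)
      (𝕊.trans (𝕊.*-congˡ {V s} ([x+1]*alternatingSum x+z≈0 odd))
      (𝕊.*-congˡ {V s} (𝕊.+-congʳ {const 1#} (𝕊.trans (monomial-^ (q ^ s) (fromℕ s) w) (monomial-cong q^≈ (sym (×1-homo-* w s)))))))))
      where
      open AlternatingGeometricSum seriesSemiring
      D = denominator (q ^ s) (fromℕ s)
      H = sumˢ {suc (w ℕ.∸ 1)} (λ i → monomial (- (q ^ s)) (fromℕ s) ^ˢ toℕ i)
      q^≈ : (q ^ s) ^ w ≈ q ^ (w ℕ.* s)
      q^≈ = trans (^-assocʳ q s w) (reflexive (≡.cong (q ^_) (ℕ.*-comm s w)))
      x+z≈0 : monomial (q ^ s) (fromℕ s) ⊕ monomial (- (q ^ s)) (fromℕ s) ≐ const 0#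
      x+z≈0 = 𝕊.trans (𝕊.sym (⊛-distribʳ-⊕ (exp (fromℕ s)) (const (q ^ s)) (const (- (q ^ s)))))
        (𝕊.trans (𝕊.*-congʳ {exp (fromℕ s)} r-r≐0) (⊛-zeroˡ (exp (fromℕ s))))
        where
        r-r≐0 : const (q ^ s) ⊕ const (- (q ^ s)) ≐ const 0#
        r-r≐0 zero    = -‿inverseʳ _
        r-r≐0 (suc _) = +-identityˡ _

    -- The equations yield ua = vb = cs = N, so both exponentials and the numerator left by the
    -- alternating sum involve `N` alone. Only the weight in the upper limit of `T` has to be odd.
    trinomialSum≈symmetricValue : ∀ n a b c u v s N →
      b ℕ.* c ≡ u → a ℕ.* c ≡ v → a ℕ.* b ≡ s → a ℕ.* b ℕ.* c ≡ N → Odd c →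
      (∑[k+l+m= n ] summand q y₁ y₂ n a b c u v s) ≈ symmetricValue n N u v s
    trinomialSum≈symmetricValue n a b c u v s N bc≡u ac≡v ab≡s abc≡N odd = begin
      (∑[k+l+m= n ] summand q y₁ y₂ n a b c u v s)  ≈⟨ trinomial-⊛ n (fromℕ (n !)) F G H (summand q y₁ y₂ n a b c u v s) term ⟩
      fromℕ (n !) * (F ⊛ (G ⊛ H)) n  ≈⟨ *-congˡ (rearranged n) ⟩
      symmetricValue n N u v s ∎
      where
      F = const (fromℕ 2) ⊛ V u ⊛ exp (fromℕ u * (fromℕ a * y₁))
      G = const (fromℕ 2) ⊛ V v ⊛ exp (fromℕ v * (fromℕ b * y₂))
      H = sumˢ {suc (c ℕ.∸ 1)} (λ i → monomial (- (q ^ s)) (fromℕ s) ^ˢ toℕ i)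

      ua≡N : u ℕ.* a ≡ N
      ua≡N = ≡.trans (≡.cong (ℕ._* a) (≡.sym bc≡u)) (≡.trans
        (solveᴺ 3 (λ a b c → (b :*ᴺ c) :*ᴺ a :=ᴺ a :*ᴺ b :*ᴺ c) ≡.refl a b c) abc≡N)
      vb≡N : v ℕ.* b ≡ N
      vb≡N = ≡.trans (≡.cong (ℕ._* b) (≡.sym ac≡v)) (≡.trans
        (solveᴺ 3 (λ a b c → (a :*ᴺ c) :*ᴺ b :=ᴺ a :*ᴺ b :*ᴺ c) ≡.refl a b c) abc≡N)
      cs≡N : c ℕ.* s ≡ N
      cs≡N = ≡.trans (≡.cong (c ℕ.*_) (≡.sym ab≡s)) (≡.trans (ℕ.*-comm c (a ℕ.* b)) abc≡N)

      exp≐ : ∀ m a y → m ℕ.* a ≡ N → exp (fromℕ m * (fromℕ a * y)) ≐ exp (fromℕ N * y)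
      exp≐ m a y ≡.refl = exp-cong (trans (sym (*-assoc _ _ _)) (*-congʳ (sym (×1-homo-* m a))))

      rearranged : F ⊛ (G ⊛ H) ≐ numerator N ⊛ (V u ⊛ V v ⊛ V s)
      rearranged = 𝕊.trans
        (𝕊.*-cong (𝕊.*-congˡ {const (fromℕ 2) ⊛ V u} (exp≐ u a y₁ ua≡N))
          (𝕊.*-cong (𝕊.*-congˡ {const (fromℕ 2) ⊛ V v} (exp≐ v b y₂ vb≡N)) (alternatingSum≐ s N odd cs≡N)))
        (solveˢ 7 (λ t U e W f S d → (t :*ˢ U :*ˢ e) :*ˢ ((t :*ˢ W :*ˢ f) :*ˢ (S :*ˢ d))
                       :=ˢ ((t :*ˢ e) :*ˢ (t :*ˢ f) :*ˢ d) :*ˢ (U :*ˢ W :*ˢ S)) 𝕊.refl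
           (const (fromℕ 2)) (V u) (exp (fromℕ N * y₁)) (V v) (exp (fromℕ N * y₂)) (V s) (denominator (q ^ N) (fromℕ N)))

      ^-fromℕ-* : ∀ i j {m} k → i ℕ.* j ≡ m → fromℕ i ^ k * fromℕ j ^ k ≈ fromℕ m ^ k
      ^-fromℕ-* i j k ≡.refl = trans (sym (^-distrib-* _ _ k)) (^-congˡ k (sym (×1-homo-* i j)))

      term : ∀ k l → k ℕ.≤ n → l ℕ.≤ n ℕ.∸ k → let m = n ℕ.∸ k ℕ.∸ l in
        summand q y₁ y₂ n a b c u v s k l m ≈ fromℕ (n !) * (F k * (G l * H m))
      term k l k≤n l≤n∸k = begin
        M * e₁ * e₂ * τ * A ^ (l ℕ.+ m) * B ^ (k ℕ.+ m) * C ^ (k ℕ.+ l)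
          ≈⟨ *-cong (*-cong (*-congˡ (^-homo-* A l m)) (^-homo-* B k m)) (^-homo-* C k l) ⟩
        M * e₁ * e₂ * τ * (A ^ l * A ^ m) * (B ^ k * B ^ m) * (C ^ k * C ^ l)
          ≈⟨ solve 10 (λ M x y z al am bk bm ck cl → M :* x :* y :* z :* (al :* am) :* (bk :* bm) :* (ck :* cl)
                         := M :* ((x :* (bk :* ck)) :* ((y :* (al :* cl)) :* (z :* (am :* bm))))) refl
               M e₁ e₂ τ (A ^ l) (A ^ m) (B ^ k) (B ^ m) (C ^ k) (C ^ l) ⟩
        M * ((e₁ * (B ^ k * C ^ k)) * ((e₂ * (A ^ l * C ^ l)) * (τ * (A ^ m * B ^ m))))
          ≈⟨ *-congˡ (*-cong (*-congˡ (^-fromℕ-* b c k bc≡u)) (*-cong (*-congˡ (^-fromℕ-* a c l ac≡v)) (*-congˡ (^-fromℕ-* a b m ab≡s)))) ⟩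
        M * ((e₁ * fromℕ u ^ k) * ((e₂ * fromℕ v ^ l) * (τ * fromℕ s ^ m)))
          ≈⟨ *-congˡ (*-cong (E-series k (q ^ u) (fromℕ a * y₁) (fromℕ u))
               (*-cong (E-series l (q ^ v) (fromℕ b * y₂) (fromℕ v)) (T-series m (q ^ s) (fromℕ s) (c ℕ.∸ 1)))) ⟩
        M * ((fromℕ (k !) * F k) * ((fromℕ (l !) * G l) * (fromℕ (m !) * H m)))
          ≈⟨ solve 7 (λ M i f j g k h → M :* ((i :* f) :* ((j :* g) :* (k :* h))) := (M :* (i :* j :* k)) :* (f :* (g :* h))) refl
               M (fromℕ (k !)) (F k) (fromℕ (l !)) (G l) (fromℕ (m !)) (H m) ⟩
        (M * (fromℕ (k !) * fromℕ (l !) * fromℕ (m !))) * (F k * (G l * H m))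
          ≈⟨ *-congʳ (trans (×1-homo-* (multinomial n k l m) _) (*-congˡ (trans
               (×1-homo-* (k ! ℕ.* l !) (m !)) (*-congʳ (×1-homo-* (k !) (l !)))))) ⟨
        fromℕ (multinomial n k l m ℕ.* (k ! ℕ.* l ! ℕ.* m !)) * (F k * (G l * H m))
          ≈⟨ *-congʳ (reflexive (≡.cong fromℕ (multinomial*k!l!m!≡n! n k l k≤n l≤n∸k))) ⟩
        fromℕ (n !) * (F k * (G l * H m)) ∎
        where
        m = n ℕ.∸ k ℕ.∸ l
        M = fromℕ (multinomial n k l m)
        A = fromℕ a
        B = fromℕ b
        C = fromℕ c
        e₁ = E k (q ^ u) (fromℕ a * y₁)
        e₂ = E l (q ^ v) (fromℕ b * y₂)
        τ = T m (q ^ s) (c ℕ.∸ 1)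

    symmetricValue-swap₁₂ : ∀ n N u v s → symmetricValue n N u v s ≈ symmetricValue n N v u s
    symmetricValue-swap₁₂ n N u v s = *-congˡ (⊛-cong {numerator N} (λ _ → refl) (𝕊.*-congʳ {V s} (⊛-comm (V u) (V v))) n)

    symmetricValue-swap₂₃ : ∀ n N u v s → symmetricValue n N u v s ≈ symmetricValue n N u s v
    symmetricValue-swap₂₃ n N u v s = *-congˡ (⊛-cong {numerator N} (λ _ → refl)
      (solveˢ 3 (λ u v s → u :*ˢ v :*ˢ s :=ˢ u :*ˢ s :*ˢ v) 𝕊.refl (V u) (V v) (V s)) n)

-- The order on absolute values, and divisibility by p

<ᵛ-irrefl : ∀ {v} → ¬ v <ᵛ v
<ᵛ-irrefl (p^<p^ s<s) = ℚ.<-irrefl ≡.refl s<s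

<ᵛ⇒≤ᵛ : ∀ {v w} → v <ᵛ w → v ≤ᵛ w
<ᵛ⇒≤ᵛ 0<p^        = 0≤
<ᵛ⇒≤ᵛ (p^<p^ s<t) = p^≤p^ (ℚ.<⇒≤ s<t)

≤ᵛ-refl : ∀ {v} → v ≤ᵛ v
≤ᵛ-refl {0ᵛ}   = 0≤
≤ᵛ-refl {p^ s} = p^≤p^ ℚ.≤-refl

≤ᵛ-trans : ∀ {u v w} → u ≤ᵛ v → v ≤ᵛ w → u ≤ᵛ w
≤ᵛ-trans 0≤          _           = 0≤
≤ᵛ-trans (p^≤p^ s≤t) (p^≤p^ t≤r) = p^≤p^ (ℚ.≤-trans s≤t t≤r)

≤ᵛ-<ᵛ-trans : ∀ {u v w} → u ≤ᵛ v → v <ᵛ w → u <ᵛ w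
≤ᵛ-<ᵛ-trans 0≤          0<p^        = 0<p^
≤ᵛ-<ᵛ-trans 0≤          (p^<p^ _)   = 0<p^
≤ᵛ-<ᵛ-trans (p^≤p^ s≤t) (p^<p^ t<r) = p^<p^ (ℚ.≤-<-trans s≤t t<r)

<ᵛ-trans : ∀ {u v w} → u <ᵛ v → v <ᵛ w → u <ᵛ w
<ᵛ-trans u<v v<w = ≤ᵛ-<ᵛ-trans (<ᵛ⇒≤ᵛ u<v) v<w

⊔ᵛ-sel : ∀ v w → v ⊔ᵛ w ≡ v ⊎ v ⊔ᵛ w ≡ w
⊔ᵛ-sel 0ᵛ     w      = inj₂ ≡.refl
⊔ᵛ-sel (p^ s) 0ᵛ     = inj₁ ≡.refl
⊔ᵛ-sel (p^ s) (p^ t) = Sum.map (≡.cong p^_) (≡.cong p^_) (ℚ.⊔-sel s t)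

·ᵛ-≤1-<1 : ∀ {v w} → v ≤ᵛ 1ᵛ → w <ᵛ 1ᵛ → v ·ᵛ w <ᵛ 1ᵛ
·ᵛ-≤1-<1 0≤          _           = 0<p^
·ᵛ-≤1-<1 (p^≤p^ _)   0<p^        = 0<p^
·ᵛ-≤1-<1 (p^≤p^ s≤0) (p^<p^ t<0) = p^<p^ (ℚ.+-mono-≤-< s≤0 t<0)

expRadius<1 : ∀ {p} (p-prime : Prime p) → expRadius p-prime <ᵛ 1ᵛ
expRadius<1 {p} p-prime = p^<p^ (ℚ.neg-antimono-< (ℚ.positive⁻¹ (ℚ.normalize 1 (p ℕ.∸ 1)) {{ℚ.normalize-pos 1 (p ℕ.∸ 1)}}))
  where instance
    p∸1≢0 : NonZero (p ℕ.∸ 1)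
    p∸1≢0 = ℕ.>-nonZero (ℕ.m<n⇒0<n∸m (ℕ.nonTrivial⇒n>1 p {{prime⇒nonTrivial p-prime}}))

-- Each exponent counted by `ord` is at least 1, so each would make p a divisor.
p∤m⇒ord≡0 : ∀ {p m} → ¬ p ∣ m → ord p m ≡ 0
p∤m⇒ord≡0 {p} {m} p∤m = ≡.cong List.length
  (filter-none (λ j → p ℕ.^ suc j ∣? m)
    (All.universal (λ j pʲ⁺¹∣m → p∤m (ℕ.∣-trans (ℕ.m∣m*n (p ℕ.^ j)) pʲ⁺¹∣m)) (List.upTo m)))

oddPrime∤2 : ∀ {p} → Prime p → Odd p → ¬ p ∣ 2
oddPrime∤2 p-prime (zero , ≡.refl) = contradiction p-prime ¬prime[1]
oddPrime∤2 p-prime (suc k , ≡.refl) p∣2 with ℕ.s≤s (ℕ.s≤s p-2≤0) ← ℕ.∣⇒≤ p∣2 =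
  contradiction (ℕ.≤-trans (ℕ.m≤n+m (suc (k ℕ.+ 0)) k) p-2≤0) λ ()

module _ {c ℓ₁ ℓ₂} (K : ValuedField c ℓ₁ ℓ₂) where
  open ValuedField K

  ⁻¹-inverseʳ : ∀ x → ∣ x ∣ ≢ 0ᵛ → x * x ⁻¹ ≈ 1#
  ⁻¹-inverseʳ x = inverse-inverseʳ ∣ x ∣ ≡.refl
    where
    open RingProperties (CommutativeRing.ring commutativeRing) using (-0#≈0#)
    inverse-inverseʳ : ∀ v (eq : ∣ x ∣ ≡ v) → v ≢ 0ᵛ → x * inverse x v eq ≈ 1#
    inverse-inverseʳ 0ᵛ     eq 0≢0 = contradiction ≡.refl 0≢0
    inverse-inverseʳ (p^ s) eq _   = trans
      -- Apartness of x from 0 supplies an inverse of x - 0, not literally of x.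
      (*-congʳ (sym (trans (+-congˡ -0#≈0#) (+-identityʳ x))))
      (proj₂ (proj₂ (#⇒invertible (Equivalence.from ∣∣-pos (≡.subst (0ᵛ <ᵛ_) (≡.sym eq) 0<p^)))))

-- Built directly in lowest terms (the stored 0 is the denominator minus one), so that `padicAbs`
-- can read off numerator and denominator by computation.
ℕ→ℚ : ℕ → ℚ
ℕ→ℚ n = ℚ.mkℚ (+ n) 0 (Coprime.sym (1-coprimeTo n))

ℕ→ℚ-suc : ∀ n → ℕ→ℚ (suc n) ≡ 1ℚ ℚ.+ ℕ→ℚ n
ℕ→ℚ-suc n = ≡.trans (≡.sym (ℚ.↥p/↧p≡p (ℕ→ℚ (suc n)))) (ℚ./-cong (≡.cong (λ i → ℤ.1ℤ ℤ.+ i) (≡.sym (ℤ.*-identityʳ (+ n)))) ≡.refl)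

-- Absolute values of integers and of qᵐ ± 1

module PadicAbsoluteValue {p c ℓ₁ ℓ₂} (p-prime : Prime p) (p-odd : Odd p) (C : PadicComplexNumbers p c ℓ₁ ℓ₂) where
  open PadicComplexNumbers C
  open ValuedField ℂₚ
  open Euler ℂₚ
  private
    module ℚₚ  = IsCompletion ℚₚ-isCompletion
    module ℚₚᵃ = IsAlgebraicClosure ℚₚᵃ-isAlgebraicClosure
    module ℂₚ  = IsCompletion ℂₚ-isCompletion

  ℚ→ℂₚ : ℚ → Carrier
  ℚ→ℂₚ x = ℚₚᵃ→ℂₚ (ℚₚ→ℚₚᵃ (ℚ→ℚₚ x))

  ∣ℚ→ℂₚ∣ : ∀ x → ∣ ℚ→ℂₚ x ∣ ≡ padicAbs p x
  ∣ℚ→ℂₚ∣ x = ≡.trans (ℂₚ.isometric _) (≡.trans (ℚₚᵃ.isometric _) (ℚₚ.isometric x))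

  ℚ→ℂₚ-isHomomorphism : IsFieldHomomorphism ℚ.heytingField heytingField ℚ→ℂₚ
  ℚ→ℂₚ-isHomomorphism = isRingHomomorphism trans
    (isRingHomomorphism (ValuedField.trans ℚₚᵃ) ℚₚ.isHomomorphism ℚₚᵃ.isHomomorphism) ℂₚ.isHomomorphism

  open RingMorphisms.IsRingHomomorphism ℚ→ℂₚ-isHomomorphism using (+-homo; 0#-homo; 1#-homo; -‿homo)

  ℚ→ℂₚ-fromℕ : ∀ n → ℚ→ℂₚ (ℕ→ℚ n) ≈ fromℕ n
  ℚ→ℂₚ-fromℕ zero    = 0#-homo
  ℚ→ℂₚ-fromℕ (suc n) = trans (reflexive (≡.cong ℚ→ℂₚ (ℕ→ℚ-suc n)))
    (trans (+-homo 1ℚ (ℕ→ℚ n)) (+-cong 1#-homo (ℚ→ℂₚ-fromℕ n)))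

  -- Integers come from ℚ, and each of the three embeddings up to ℂₚ is isometric.
  ∣fromℕ∣ : ∀ n → ∣ fromℕ n ∣ ≡ padicAbs p (ℕ→ℚ n)
  ∣fromℕ∣ n = ≡.trans (∣∣-cong (sym (ℚ→ℂₚ-fromℕ n))) (∣ℚ→ℂₚ∣ (ℕ→ℚ n))

  -- The p-adic absolute value of a positive integer is by computation a power of p, hence not `0ᵛ`.
  fromℕ-inverse : ∀ n .{{_ : NonZero n}} → fromℕ n * fromℕ n ⁻¹ ≈ 1#
  fromℕ-inverse n@(suc _) = ⁻¹-inverseʳ ℂₚ (fromℕ n) λ ∣n∣≡0 → case ≡.trans (≡.sym (∣fromℕ∣ n)) ∣n∣≡0 of λ ()

  ord-1≡0 : ord p 1 ≡ 0
  ord-1≡0 = p∤m⇒ord≡0 (λ p∣1 → oddPrime∤2 p-prime p-odd (ℕ.∣-trans p∣1 (ℕ.1∣ 2)))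

  ∣0∣≡0 : ∣ 0# ∣ ≡ 0ᵛ
  ∣0∣≡0 = ∣fromℕ∣ 0

  ∣1∣≡1 : ∣ 1# ∣ ≡ 1ᵛ
  ∣1∣≡1 = ≡.trans (∣∣-cong (sym 1#-homo)) (≡.trans (∣ℚ→ℂₚ∣ 1ℚ)
    (≡.cong₂ (λ i j → p^ ((+ i ℤ.- + j) ℚ./ 1)) ord-1≡0 ord-1≡0))

  ∣-1∣≡1 : ∣ - 1# ∣ ≡ 1ᵛ
  ∣-1∣≡1 = ≡.trans (∣∣-cong (sym (trans (-‿homo 1ℚ) (-‿cong 1#-homo)))) (≡.trans (∣ℚ→ℂₚ∣ (ℚ.- 1ℚ))
    (≡.cong₂ (λ i j → p^ ((+ i ℤ.- + j) ℚ./ 1)) ord-1≡0 ord-1≡0))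

  ∣2∣≡1 : ∣ fromℕ 2 ∣ ≡ 1ᵛ
  ∣2∣≡1 = ≡.trans (∣fromℕ∣ 2)
    (≡.cong₂ (λ i j → p^ ((+ i ℤ.- + j) ℚ./ 1)) ord-1≡0 (p∤m⇒ord≡0 (oddPrime∤2 p-prime p-odd)))

  ∣+∣<1 : ∀ {x y} → ∣ x ∣ <ᵛ 1ᵛ → ∣ y ∣ <ᵛ 1ᵛ → ∣ x + y ∣ <ᵛ 1ᵛ
  ∣+∣<1 {x} {y} ∣x∣<1 ∣y∣<1 = ≤ᵛ-<ᵛ-trans (∣∣-ultra x y)
    ([ (λ eq → ≡.subst (_<ᵛ 1ᵛ) (≡.sym eq) ∣x∣<1) , (λ eq → ≡.subst (_<ᵛ 1ᵛ) (≡.sym eq) ∣y∣<1) ]′ (⊔ᵛ-sel ∣ x ∣ ∣ y ∣))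

  ∣*∣<1 : ∀ {x y} → ∣ x ∣ ≤ᵛ 1ᵛ → ∣ y ∣ <ᵛ 1ᵛ → ∣ x * y ∣ <ᵛ 1ᵛ
  ∣*∣<1 {x} {y} ∣x∣≤1 ∣y∣<1 = ≡.subst (_<ᵛ 1ᵛ) (≡.sym (∣∣-* x y)) (·ᵛ-≤1-<1 ∣x∣≤1 ∣y∣<1)

  open SetoidReasoning setoid

  module _ {q} (∣q-1∣<1 : ∣ q - 1# ∣ <ᵛ 1ᵛ) where

    ∣q∣≤1 : ∣ q ∣ ≤ᵛ 1ᵛ
    ∣q∣≤1 = ≡.subst (_≤ᵛ 1ᵛ) (∣∣-cong q-1+1≈q) (≤ᵛ-trans (∣∣-ultra (q - 1#) 1#)
      ([ (λ eq → ≡.subst (_≤ᵛ 1ᵛ) (≡.sym eq) (<ᵛ⇒≤ᵛ ∣q-1∣<1))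
       , (λ eq → ≡.subst (_≤ᵛ 1ᵛ) (≡.sym (≡.trans eq ∣1∣≡1)) ≤ᵛ-refl) ]′ (⊔ᵛ-sel ∣ q - 1# ∣ ∣ 1# ∣)))
      where
      q-1+1≈q : (q - 1#) + 1# ≈ q
      q-1+1≈q = trans (+-assoc _ _ _) (trans (+-congˡ (-‿inverseˡ 1#)) (+-identityʳ q))

    -- Induction through q^(m+1) - 1 = q(q^m - 1) + (q - 1), with |q| ≤ 1 and the ultrametric
    -- inequality.
    ∣q^m-1∣<1 : ∀ m → ∣ q ^ m - 1# ∣ <ᵛ 1ᵛ
    ∣q^m-1∣<1 zero    = ≡.subst (_<ᵛ 1ᵛ) (≡.sym (≡.trans (∣∣-cong (-‿inverseʳ 1#)) ∣0∣≡0)) 0<p^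
    ∣q^m-1∣<1 (suc m) = ≡.subst (_<ᵛ 1ᵛ) (∣∣-cong telescope)
      (∣+∣<1 (∣*∣<1 ∣q∣≤1 (∣q^m-1∣<1 m)) ∣q-1∣<1)
      where
      open RingProperties (CommutativeRing.ring commutativeRing) using (-‿distribʳ-*)
      telescope : q * (q ^ m - 1#) + (q - 1#) ≈ q * q ^ m - 1#
      telescope = begin
        q * (q ^ m - 1#) + (q - 1#)           ≈⟨ +-congʳ (distribˡ q (q ^ m) (- 1#)) ⟩
        (q * q ^ m + q * - 1#) + (q - 1#)     ≈⟨ +-congʳ (+-congˡ (trans (sym (-‿distribʳ-* q 1#)) (-‿cong (*-identityʳ q)))) ⟩
        (q * q ^ m + - q) + (q + - 1#)        ≈⟨ +-assoc _ _ _ ⟩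
        q * q ^ m + (- q + (q + - 1#))        ≈⟨ +-congˡ (+-assoc _ _ _) ⟨
        q * q ^ m + ((- q + q) + - 1#)        ≈⟨ +-congˡ (trans (+-congʳ (-‿inverseˡ q)) (+-identityˡ _)) ⟩
        q * q ^ m - 1#                        ∎

    -- Otherwise 2 = (qᵐ + 1) - (qᵐ - 1) would have absolute value < 1.
    ∣q^m+1∣≢0 : ∀ m → ∣ q ^ m + 1# ∣ ≢ 0ᵛ
    ∣q^m+1∣≢0 m ∣r+1∣≡0 = <ᵛ-irrefl (≡.subst (_<ᵛ 1ᵛ) (≡.trans (∣∣-cong difference≈2) ∣2∣≡1)
      (∣+∣<1 (≡.subst (_<ᵛ 1ᵛ) (≡.sym ∣r+1∣≡0) 0<p^)
        (∣*∣<1 (≡.subst (_≤ᵛ 1ᵛ) (≡.sym ∣-1∣≡1) ≤ᵛ-refl) (∣q^m-1∣<1 m))))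
      where
      open RingProperties (CommutativeRing.ring commutativeRing) using (-1*x≈-x; -‿involutive; -‿+-comm)
      r = q ^ m
      difference≈2 : (r + 1#) + - 1# * (r - 1#) ≈ fromℕ 2
      difference≈2 = begin
        (r + 1#) + - 1# * (r - 1#)    ≈⟨ +-cong (+-comm r 1#) (trans (-1*x≈-x _)
               (trans (sym (-‿+-comm r (- 1#))) (+-congˡ (-‿involutive 1#)))) ⟩
        (1# + r) + (- r + 1#)         ≈⟨ +-assoc _ _ _ ⟩
        1# + (r + (- r + 1#))         ≈⟨ +-congˡ (+-assoc _ _ _) ⟨
        1# + ((r + - r) + 1#)         ≈⟨ +-congˡ (+-congʳ (-‿inverseʳ r)) ⟩
        1# + (0# + 1#)                ≈⟨ +-congˡ (+-comm _ _) ⟩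
        fromℕ 2                       ∎

-- The six sums as values of one symmetric expression

theorem4p2 :
  ∀ {c ℓ₁ ℓ₂ : Level} (p : ℕ) (p-prime : Prime p) → Odd p → (C : PadicComplexNumbers p c ℓ₁ ℓ₂) →
  let open PadicComplexNumbers C
      open ValuedField ℂₚ
      open Euler ℂₚ
  in
  (q : Carrier) → ∣ q - 1# ∣ <ᵛ expRadius p-prime →
  (w₁ w₂ w₃ : ℕ) → Odd w₁ → Odd w₂ → Odd w₃ →
  (n : ℕ) (y₁ y₂ : ℤₚ) →
  let
    S₁ = ∑[k+l+m= n ] λ k l m → fromℕ (multinomial n k l m) * E k (q ^ (w₂ ℕ.* w₃)) (fromℕ w₁ * ℤₚ→ℂₚ y₁) * E l (q ^ (w₁ ℕ.* w₃)) (fromℕ w₂ * ℤₚ→ℂₚ y₂) * T m (q ^ (w₁ ℕ.* w₂)) (w₃ ℕ.∸ 1)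
             * fromℕ w₁ ^ (l ℕ.+ m) * fromℕ w₂ ^ (k ℕ.+ m) * fromℕ w₃ ^ (k ℕ.+ l)
    S₂ = ∑[k+l+m= n ] λ k l m → fromℕ (multinomial n k l m) * E k (q ^ (w₂ ℕ.* w₃)) (fromℕ w₁ * ℤₚ→ℂₚ y₁) * E l (q ^ (w₁ ℕ.* w₂)) (fromℕ w₃ * ℤₚ→ℂₚ y₂) * T m (q ^ (w₁ ℕ.* w₃)) (w₂ ℕ.∸ 1)
             * fromℕ w₁ ^ (l ℕ.+ m) * fromℕ w₃ ^ (k ℕ.+ m) * fromℕ w₂ ^ (k ℕ.+ l)
    S₃ = ∑[k+l+m= n ] λ k l m → fromℕ (multinomial n k l m) * E k (q ^ (w₁ ℕ.* w₃)) (fromℕ w₂ * ℤₚ→ℂₚ y₁) * E l (q ^ (w₂ ℕ.* w₃)) (fromℕ w₁ * ℤₚ→ℂₚ y₂) * T m (q ^ (w₁ ℕ.* w₂)) (w₃ ℕ.∸ 1)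
             * fromℕ w₂ ^ (l ℕ.+ m) * fromℕ w₁ ^ (k ℕ.+ m) * fromℕ w₃ ^ (k ℕ.+ l)
    S₄ = ∑[k+l+m= n ] λ k l m → fromℕ (multinomial n k l m) * E k (q ^ (w₁ ℕ.* w₃)) (fromℕ w₂ * ℤₚ→ℂₚ y₁) * E l (q ^ (w₁ ℕ.* w₂)) (fromℕ w₃ * ℤₚ→ℂₚ y₂) * T m (q ^ (w₂ ℕ.* w₃)) (w₁ ℕ.∸ 1)
             * fromℕ w₂ ^ (l ℕ.+ m) * fromℕ w₃ ^ (k ℕ.+ m) * fromℕ w₁ ^ (k ℕ.+ l)
    S₅ = ∑[k+l+m= n ] λ k l m → fromℕ (multinomial n k l m) * E k (q ^ (w₁ ℕ.* w₂)) (fromℕ w₃ * ℤₚ→ℂₚ y₁) * E l (q ^ (w₁ ℕ.* w₃)) (fromℕ w₂ * ℤₚ→ℂₚ y₂) * T m (q ^ (w₂ ℕ.* w₃)) (w₁ ℕ.∸ 1)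
             * fromℕ w₃ ^ (l ℕ.+ m) * fromℕ w₂ ^ (k ℕ.+ m) * fromℕ w₁ ^ (k ℕ.+ l)
    S₆ = ∑[k+l+m= n ] λ k l m → fromℕ (multinomial n k l m) * E k (q ^ (w₁ ℕ.* w₂)) (fromℕ w₃ * ℤₚ→ℂₚ y₁) * E l (q ^ (w₂ ℕ.* w₃)) (fromℕ w₁ * ℤₚ→ℂₚ y₂) * T m (q ^ (w₁ ℕ.* w₃)) (w₂ ℕ.∸ 1)
             * fromℕ w₃ ^ (l ℕ.+ m) * fromℕ w₁ ^ (k ℕ.+ m) * fromℕ w₂ ^ (k ℕ.+ l)
  in S₁ ≈ S₂ × S₂ ≈ S₃ × S₃ ≈ S₄ × S₄ ≈ S₅ × S₅ ≈ S₆
theorem4p2 p p-prime p-odd C q ∣q-1∣<R w₁ w₂ w₃ odd₁ odd₂ odd₃ n y₁ y₂ =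
    -- The sums realize the six orders of P, Q, R. Neighbours differ by one adjacent transposition,
    -- except the second and third, PRQ and QPR, which need two.
    trans S₁≈ (trans (swap₂₃ P Q R) (sym S₂≈))
  , trans S₂≈ (trans (swap₂₃ P R Q) (trans (swap₁₂ P Q R) (sym S₃≈)))
  , trans S₃≈ (trans (swap₂₃ Q P R) (sym S₄≈))
  , trans S₄≈ (trans (swap₁₂ Q R P) (sym S₅≈))
  , trans S₅≈ (trans (swap₂₃ R Q P) (sym S₆≈))
  where
  open PadicComplexNumbers C
  open ValuedField ℂₚ
  open Euler ℂₚ
  open PadicAbsoluteValue p-prime p-odd C
  open EulerSeries ℂₚ fromℕ-inverse
  open TrinomialSum ℂₚ
  open +-*-Solver using (solve; _:*_; _:=_)

  P = w₂ ℕ.* w₃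
  Q = w₁ ℕ.* w₃
  R = w₁ ℕ.* w₂
  N = w₁ ℕ.* w₂ ℕ.* w₃

  -- The radius p^(-1/(p-1)) is below 1, so |q - 1| < 1 and qᵐ + 1 has nonzero absolute value;
  -- `denominator-0` transfers this to the constant coefficient as computed.
  unit : ∀ m → denominator (q ^ m) 1# 0 * denominator (q ^ m) 1# 0 ⁻¹ ≈ 1#
  unit m = ⁻¹-inverseʳ ℂₚ _ λ eq →
    ∣q^m+1∣≢0 (<ᵛ-trans ∣q-1∣<R (expRadius<1 p-prime)) m (≡.trans (∣∣-cong (sym (denominator-0 (q ^ m)))) eq)

  value : ℕ → ℕ → ℕ → Carrier
  value = symmetricValue q unit (ℤₚ→ℂₚ y₁) (ℤₚ→ℂₚ y₂) n N

  swap₁₂ : ∀ u v s → value u v s ≈ value v u s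
  swap₁₂ = symmetricValue-swap₁₂ q unit (ℤₚ→ℂₚ y₁) (ℤₚ→ℂₚ y₂) n N

  swap₂₃ : ∀ u v s → value u v s ≈ value u s v
  swap₂₃ = symmetricValue-swap₂₃ q unit (ℤₚ→ℂₚ y₁) (ℤₚ→ℂₚ y₂) n N

  sumFor : ℕ → ℕ → ℕ → ℕ → ℕ → ℕ → Carrier
  sumFor a b c u v s = ∑[k+l+m= n ] summand q (ℤₚ→ℂₚ y₁) (ℤₚ→ℂₚ y₂) n a b c u v s

  sum≈ : ∀ a b c u v s → b ℕ.* c ≡ u → a ℕ.* c ≡ v → a ℕ.* b ≡ s → a ℕ.* b ℕ.* c ≡ N → Odd c →
    sumFor a b c u v s ≈ value u v s
  sum≈ a b c u v s = trinomialSum≈symmetricValue q unit (ℤₚ→ℂₚ y₁) (ℤₚ→ℂₚ y₂) n a b c u v s N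

  S₁≈ : sumFor w₁ w₂ w₃ P Q R ≈ value P Q R
  S₁≈ = sum≈ w₁ w₂ w₃ P Q R ≡.refl ≡.refl ≡.refl ≡.refl odd₃

  S₂≈ : sumFor w₁ w₃ w₂ P R Q ≈ value P R Q
  S₂≈ = sum≈ w₁ w₃ w₂ P R Q (ℕ.*-comm w₃ w₂) ≡.refl ≡.refl
    (solve 3 (λ a b c → a :* c :* b := a :* b :* c) ≡.refl w₁ w₂ w₃) odd₂

  S₃≈ : sumFor w₂ w₁ w₃ Q P R ≈ value Q P R
  S₃≈ = sum≈ w₂ w₁ w₃ Q P R ≡.refl ≡.refl (ℕ.*-comm w₂ w₁)
    (solve 3 (λ a b c → b :* a :* c := a :* b :* c) ≡.refl w₁ w₂ w₃) odd₃

  S₄≈ : sumFor w₂ w₃ w₁ Q R P ≈ value Q R P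
  S₄≈ = sum≈ w₂ w₃ w₁ Q R P (ℕ.*-comm w₃ w₁) (ℕ.*-comm w₂ w₁) ≡.refl
    (solve 3 (λ a b c → b :* c :* a := a :* b :* c) ≡.refl w₁ w₂ w₃) odd₁

  S₅≈ : sumFor w₃ w₂ w₁ R Q P ≈ value R Q P
  S₅≈ = sum≈ w₃ w₂ w₁ R Q P (ℕ.*-comm w₂ w₁) (ℕ.*-comm w₃ w₁) (ℕ.*-comm w₃ w₂)
    (solve 3 (λ a b c → c :* b :* a := a :* b :* c) ≡.refl w₁ w₂ w₃) odd₁

  S₆≈ : sumFor w₃ w₁ w₂ R P Q ≈ value R P Q
  S₆≈ = sum≈ w₃ w₁ w₂ R P Q ≡.refl (ℕ.*-comm w₃ w₂) (ℕ.*-comm w₃ w₁)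
    (solve 3 (λ a b c → c :* a :* b := a :* b :* c) ≡.refl w₁ w₂ w₃) odd₂
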